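{- Let $s=1+q$ with $q$ a prime power, and let $n=s^2-s+1$. Then there is a perfect difference set $S\subset\mathbb{Z}_n$ with $|S|=s$ and, for every integer $m\ge 1$, the bipartite graph $G_m(S)$ has $(m+1)n$ vertices, is biregular with degrees $r=ms$ and $s$ (all vertices of one stable set have degree $ms$ and all vertices of the other have degree $s$), and has diameter $3$.
   Context: A perfect difference set $S$ in $\mathbb{Z}_n$ is a subset such that every nonzero element of $\mathbb{Z}_n$ occurs exactly once in the multiset $\{t-t' : t,t'\in S\}$. For a finite group $\Gamma$ (here $\Gamma=\mathbb{Z}_n$, written additively), $S\subseteq\Gamma$ and an integer $m\ge1$, $G_m(S)=(V_0\cup V_1,E)$ is the bipartite graph with stable sets $V_0=\{(0,u):u\in\Gamma\}$ and $V_1=\{(l,v): v\in\Gamma,\ 1\le l\le m\}$, and adjacencies $(l,v)\sim(0,v+\sigma)$ for all $\sigma\in S$, $v\in\Gamma$ and $l\in\{1,\dots,m\}$. -}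

module Defs where

open import Data.Bool.Base using (Bool; true; false; not)
open import Data.Fin.Base using (Fin; zero; suc; toℕ)
open import Data.Fin.Properties using (nonZeroIndex)
open import Data.Fin.Subset using (Subset; _∈_)
open import Data.List.Base using (length)
open import Data.List.Membership.Propositional using () renaming (_∈_ to _∈ᴸ_)
open import Data.List.Relation.Unary.Unique.Propositional using (Unique)
open import Data.Nat.Base using (ℕ; suc; _+_; _∸_; _^_; _≤_; _≥_)
open import Data.Nat.DivMod using (_mod_)
open import Data.Nat.Primality using (Prime)
open import Data.Product using (_×_; _,_; ∃₂; ∃-syntax; ∃!)
open import Function.Bundles using (_⇔_)
open import Level using (0ℓ)
open import Relation.Binary.Construct.Closure.Symmetric using (SymClosure; fwd; bwd; symmetric)
open import Relation.Binary.Core using (Rel)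
open import Relation.Binary.Definitions using (Symmetric)
open import Relation.Binary.PropositionalEquality using (_≡_; _≢_)
open import Relation.Unary using (Pred; U)

IsPrimePower : ℕ → Set
IsPrimePower q = ∃₂ λ p k → Prime p × k ≥ 1 × q ≡ p ^ k

-- The additive group ℤₙ is represented by the residues Fin n.  The operands
-- themselves witness that n is nonzero, so no NonZero argument is needed.

infixl 6 _⊕_ _⊖_

_⊕_ : ∀ {n} → Fin n → Fin n → Fin n
_⊕_ {n} a b = _mod_ (toℕ a + toℕ b) n {{nonZeroIndex a}}

_⊖_ : ∀ {n} → Fin n → Fin n → Fin n
_⊖_ {n} a b = _mod_ (toℕ a + (n ∸ toℕ b)) n {{nonZeroIndex a}}

-- Multiplicity one in the multiset of differences means that exactly one
-- ordered pair (t , t′) ∈ S × S has the given difference.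
IsPerfectDifferenceSet : ∀ {n} → Subset n → Set
IsPerfectDifferenceSet {n} S =
  ∀ (d : Fin n) → toℕ d ≢ 0 →
  ∃! _≡_ λ ((t , t′) : Fin n × Fin n) → t ∈ S × t′ ∈ S × t ⊖ t′ ≡ d

-- Exactly k elements of A satisfy P.
HasCardinality : {A : Set} → Pred A 0ℓ → ℕ → Set
HasCardinality {A} P k =
  ∃[ xs ] Unique xs × (∀ (x : A) → x ∈ᴸ xs ⇔ P x) × length xs ≡ k

-- A bipartite graph with a chosen bipartition: the stable sets are the two
-- fibres of side.  Irreflexivity of adjacency follows from stable.
record BipartiteGraph : Set₁ where
  field
    Vertex : Set
    _~_    : Rel Vertex 0ℓ
    ~-sym  : Symmetric _~_
    side   : Vertex → Bool
    stable : ∀ {x y} → x ~ y → side x ≢ side y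

module _ (G : BipartiteGraph) where
  open BipartiteGraph G

  HasOrder : ℕ → Set
  HasOrder k = HasCardinality {Vertex} U k

  HasDegree : Vertex → ℕ → Set
  HasDegree x k = HasCardinality (x ~_) k

  IsBiregular : ℕ → ℕ → Set
  IsBiregular r s = ∃[ b ]
    (∀ x → side x ≡ b → HasDegree x r) ×
    (∀ x → side x ≡ not b → HasDegree x s)

  data Walk : ℕ → Vertex → Vertex → Set where
    []  : ∀ {x} → Walk 0 x x
    _∷_ : ∀ {k x y z} → x ~ y → Walk k y z → Walk (suc k) x z

  HasDistance : Vertex → Vertex → ℕ → Set
  HasDistance x y k = Walk k x y × (∀ j → Walk j x y → k ≤ j)

  -- The maximum over all pairs of the distance; in particular G is connected.
  HasDiameter : ℕ → Set
  HasDiameter d =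
    (∀ x y → ∃[ k ] HasDistance x y k × k ≤ d) ×
    (∃₂ λ x y → HasDistance x y d)

-- Vertices are pairs (l , v) with 0 ≤ l ≤ m and v ∈ ℤₙ; the layer l = 0 is V₀
-- and the layers 1 ≤ l ≤ m together form V₁.
module _ (m : ℕ) {n : ℕ} (S : Subset n) where

  data Edge : Rel (Fin (suc m) × Fin n) 0ℓ where
    edge : ∀ (l : Fin m) {v u σ} → σ ∈ S → u ≡ v ⊕ σ → Edge (suc l , v) (zero , u)

  layerSide : Fin (suc m) × Fin n → Bool
  layerSide (zero  , _) = false
  layerSide (suc _ , _) = true

  G[_,_] : BipartiteGraph
  G[_,_] = record
    { Vertex = Fin (suc m) × Fin n
    ; _~_    = SymClosure Edge
    ; ~-sym  = symmetric Edge
    ; side   = layerSide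
    ; stable = λ { (fwd (edge _ _ _)) () ; (bwd (edge _ _ _)) () }
    }

{-# OPTIONS --safe #-}

-- S is Singer's difference set.  Let θ generate the multiplicative group of the field with q³ elements.
-- Modulo n = q² + q + 1 the logarithms of 1 and of θ + φ (φ in the subfield with q elements) have
-- distinct pairwise sums: equal sums give two products of linear forms with coefficients in the
-- subfield that agree at θ up to constants of the subfield, hence also at θ^q and θ^q², hence
-- identically.  So the q (q + 1) differences of distinct elements of S are distinct and exhaust the
-- nonzero residues.
--
-- No irreducible cubic is needed to obtain the field.  With N = q³ - 1, every element of
-- A = 𝔽ₚ[X]/(Xᴺ - 1) satisfies a^(N+1) = a, since the iterated Frobenius map is additive and fixes
-- X.  The product of the 1 - X^(N/l) over the primes l dividing N is nonzero in A.  Multiplying it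
-- by further elements of A as long as the product stays nonzero ends with some e such that A/ann(e)
-- is a field in which X still has order N.
--
-- In the graph, two vertices on the same side have a common neighbour because S is a difference set;
-- nonadjacent vertices on opposite sides, which exist since s < n, are therefore at distance 3.

module Submission where

-- Arithmetic of residues modulo n

module Residues where
  open import Defs using (_⊕_; _⊖_)
  open import Algebra.Bundles using (CommutativeRing)
  open import Data.Fin.Base using (Fin; suc; toℕ)
  open import Data.Fin.Properties using (toℕ<n; toℕ-injective; toℕ-fromℕ<)
  open import Data.Nat.Base as ℕ using (ℕ; suc; _∸_)
  import Data.Nat.Properties as ℕ
  open import Data.Nat.DivMod
  open import Data.Product using (_,_; ∃₂)
  open import Level using (0ℓ)
  open import Relation.Binary.PropositionalEquality hiding ([_])

  module Modulo (m : ℕ) where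

    private
      n = suc m

    [_] : ℕ → Fin n
    [ a ] = a mod n

    toℕ-[] : ∀ a → toℕ [ a ] ≡ a % n
    toℕ-[] a = toℕ-fromℕ< (m%n<n a n)

    []-cong-% : ∀ a b → a % n ≡ b % n → [ a ] ≡ [ b ]
    []-cong-% a b eq = toℕ-injective (trans (toℕ-[] a) (trans eq (sym (toℕ-[] b))))

    []-injective-% : ∀ a b → [ a ] ≡ [ b ] → a % n ≡ b % n
    []-injective-% a b eq = trans (sym (toℕ-[] a)) (trans (cong toℕ eq) (toℕ-[] b))

    [toℕ] : ∀ a → [ toℕ a ] ≡ a
    [toℕ] a = toℕ-injective (trans (toℕ-[] (toℕ a)) (m<n⇒m%n≡m (toℕ<n a)))

    []-+ : ∀ a b → [ a ] ⊕ [ b ] ≡ [ a ℕ.+ b ]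
    []-+ a b = []-cong-% (toℕ [ a ] ℕ.+ toℕ [ b ]) (a ℕ.+ b)
      (trans (cong₂ (λ u v → (u ℕ.+ v) % n) (toℕ-[] a) (toℕ-[] b)) (sym (%-distribˡ-+ a b n)))

    infixl 7 _⊗_

    _⊗_ : Fin n → Fin n → Fin n
    a ⊗ b = [ toℕ a ℕ.* toℕ b ]

    []-* : ∀ a b → [ a ] ⊗ [ b ] ≡ [ a ℕ.* b ]
    []-* a b = []-cong-% (toℕ [ a ] ℕ.* toℕ [ b ]) (a ℕ.* b)
      (trans (cong₂ (λ u v → (u ℕ.* v) % n) (toℕ-[] a) (toℕ-[] b)) (sym (%-distribˡ-* a b n)))

    ⊝_ : Fin n → Fin n
    ⊝ a = [ n ∸ toℕ a ]

    -- Every residue is the class of its representative, so the ring laws below reduce to laws of ℕ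
    -- carried through `[]-+` and `[]-*`.
    []-elim : ∀ {P : Fin n → Set} → (∀ a → P [ a ]) → ∀ a → P a
    []-elim {P} h a = subst P ([toℕ] a) (h (toℕ a))

    ⊕-comm : ∀ (a b : Fin n) → a ⊕ b ≡ b ⊕ a
    ⊕-comm a b = cong [_] (ℕ.+-comm (toℕ a) (toℕ b))

    ⊗-comm : ∀ a b → a ⊗ b ≡ b ⊗ a
    ⊗-comm a b = cong [_] (ℕ.*-comm (toℕ a) (toℕ b))

    ⊕-assoc : ∀ (a b c : Fin n) → (a ⊕ b) ⊕ c ≡ a ⊕ (b ⊕ c)
    ⊕-assoc = []-elim λ a → []-elim λ b → []-elim λ c → begin
      ([ a ] ⊕ [ b ]) ⊕ [ c ]  ≡⟨ cong (_⊕ [ c ]) ([]-+ a b) ⟩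
      [ a ℕ.+ b ] ⊕ [ c ]      ≡⟨ []-+ (a ℕ.+ b) c ⟩
      [ a ℕ.+ b ℕ.+ c ]        ≡⟨ cong [_] (ℕ.+-assoc a b c) ⟩
      [ a ℕ.+ (b ℕ.+ c) ]      ≡⟨ []-+ a (b ℕ.+ c) ⟨
      [ a ] ⊕ [ b ℕ.+ c ]      ≡⟨ cong ([ a ] ⊕_) ([]-+ b c) ⟨
      [ a ] ⊕ ([ b ] ⊕ [ c ])  ∎
      where open ≡-Reasoning

    ⊗-assoc : ∀ a b c → (a ⊗ b) ⊗ c ≡ a ⊗ (b ⊗ c)
    ⊗-assoc = []-elim λ a → []-elim λ b → []-elim λ c → begin
      ([ a ] ⊗ [ b ]) ⊗ [ c ]  ≡⟨ cong (_⊗ [ c ]) ([]-* a b) ⟩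
      [ a ℕ.* b ] ⊗ [ c ]      ≡⟨ []-* (a ℕ.* b) c ⟩
      [ a ℕ.* b ℕ.* c ]        ≡⟨ cong [_] (ℕ.*-assoc a b c) ⟩
      [ a ℕ.* (b ℕ.* c) ]      ≡⟨ []-* a (b ℕ.* c) ⟨
      [ a ] ⊗ [ b ℕ.* c ]      ≡⟨ cong ([ a ] ⊗_) ([]-* b c) ⟨
      [ a ] ⊗ ([ b ] ⊗ [ c ])  ∎
      where open ≡-Reasoning

    ⊗-distribˡ-⊕ : ∀ a b c → a ⊗ (b ⊕ c) ≡ (a ⊗ b) ⊕ (a ⊗ c)
    ⊗-distribˡ-⊕ = []-elim λ a → []-elim λ b → []-elim λ c → begin
      [ a ] ⊗ ([ b ] ⊕ [ c ])                ≡⟨ cong ([ a ] ⊗_) ([]-+ b c) ⟩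
      [ a ] ⊗ [ b ℕ.+ c ]                    ≡⟨ []-* a (b ℕ.+ c) ⟩
      [ a ℕ.* (b ℕ.+ c) ]                    ≡⟨ cong [_] (ℕ.*-distribˡ-+ a b c) ⟩
      [ a ℕ.* b ℕ.+ a ℕ.* c ]                ≡⟨ []-+ (a ℕ.* b) (a ℕ.* c) ⟨
      [ a ℕ.* b ] ⊕ [ a ℕ.* c ]              ≡⟨ cong₂ _⊕_ ([]-* a b) ([]-* a c) ⟨
      ([ a ] ⊗ [ b ]) ⊕ ([ a ] ⊗ [ c ])      ∎
      where open ≡-Reasoning

    ⊕-identityˡ : ∀ a → [ 0 ] ⊕ a ≡ a
    ⊕-identityˡ = []-elim λ a → []-+ 0 a

    ⊗-identityˡ : ∀ a → [ 1 ] ⊗ a ≡ a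
    ⊗-identityˡ = []-elim λ a → trans ([]-* 1 a) (cong [_] (ℕ.*-identityˡ a))

    ⊝-inverseʳ : ∀ a → a ⊕ (⊝ a) ≡ [ 0 ]
    ⊝-inverseʳ a = begin
      a ⊕ (⊝ a)                     ≡⟨ cong (_⊕ (⊝ a)) ([toℕ] a) ⟨
      [ toℕ a ] ⊕ [ n ∸ toℕ a ]     ≡⟨ []-+ (toℕ a) (n ∸ toℕ a) ⟩
      [ toℕ a ℕ.+ (n ∸ toℕ a) ]     ≡⟨ cong [_] (ℕ.m+[n∸m]≡n (ℕ.<⇒≤ (toℕ<n a))) ⟩
      [ n ]                         ≡⟨ []-cong-% n 0 (n%n≡0 n) ⟩
      [ 0 ]                         ∎
      where open ≡-Reasoning

    ⊖-def : ∀ (a b : Fin n) → a ⊖ b ≡ a ⊕ (⊝ b)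
    ⊖-def a b = trans (sym ([]-+ (toℕ a) (n ∸ toℕ b))) (cong (_⊕ (⊝ b)) ([toℕ] a))

    ℤ/ : CommutativeRing 0ℓ 0ℓ
    ℤ/ = record
      { Carrier = Fin n ; _≈_ = _≡_ ; _+_ = _⊕_ ; _*_ = _⊗_ ; -_ = ⊝_ ; 0# = [ 0 ] ; 1# = [ 1 ]
      ; isCommutativeRing = record
        { isRing = record
          { +-isAbelianGroup = record
            { isGroup = record
              { isMonoid = record
                { isSemigroup = record
                  { isMagma = record { isEquivalence = isEquivalence ; ∙-cong = cong₂ _⊕_ }
                  ; assoc = ⊕-assoc }
                ; identity = ⊕-identityˡ , λ a → trans (⊕-comm a _) (⊕-identityˡ a) }
              ; inverse = (λ a → trans (⊕-comm (⊝ a) a) (⊝-inverseʳ a)) , ⊝-inverseʳ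
              ; ⁻¹-cong = cong ⊝_ }
            ; comm = ⊕-comm }
          ; *-cong = cong₂ _⊗_
          ; *-assoc = ⊗-assoc
          ; *-identity = ⊗-identityˡ , λ a → trans (⊗-comm a _) (⊗-identityˡ a)
          ; distrib = ⊗-distribˡ-⊕ , λ a b c →
              trans (⊗-comm (b ⊕ c) a) (trans (⊗-distribˡ-⊕ a b c) (cong₂ _⊕_ (⊗-comm a b) (⊗-comm a c))) }
        ; *-comm = ⊗-comm } }

    open CommutativeRing ℤ/ public using (+-abelianGroup)
    open import Algebra.Properties.AbelianGroup +-abelianGroup public
      using () renaming (∙-cancelˡ to ⊕-cancelˡ; ∙-cancelʳ to ⊕-cancelʳ)

    ⊖-⊕ : ∀ (a b : Fin n) → (a ⊖ b) ⊕ b ≡ a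
    ⊖-⊕ a b = begin
      (a ⊖ b) ⊕ b        ≡⟨ cong (_⊕ b) (⊖-def a b) ⟩
      (a ⊕ (⊝ b)) ⊕ b    ≡⟨ ⊕-assoc a (⊝ b) b ⟩
      a ⊕ ((⊝ b) ⊕ b)    ≡⟨ cong (a ⊕_) (trans (⊕-comm (⊝ b) b) (⊝-inverseʳ b)) ⟩
      a ⊕ [ 0 ]          ≡⟨ trans (⊕-comm a _) (⊕-identityˡ a) ⟩
      a                  ∎
      where open ≡-Reasoning

    ⊕-⊖ : ∀ (a b : Fin n) → (a ⊕ b) ⊖ b ≡ a
    ⊕-⊖ a b = ⊕-cancelʳ b _ _ (⊖-⊕ (a ⊕ b) b)

    -- Turns equal differences into equal sums, the form in which the Sidon property is stated.
    ⊖-≡⇒⊕-≡ : ∀ (a b c d : Fin n) → a ⊖ b ≡ c ⊖ d → a ⊕ d ≡ c ⊕ b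
    ⊖-≡⇒⊕-≡ a b c d eq = begin
      a ⊕ d                  ≡⟨ cong (_⊕ d) (⊖-⊕ a b) ⟨
      ((a ⊖ b) ⊕ b) ⊕ d      ≡⟨ cong (λ e → (e ⊕ b) ⊕ d) eq ⟩
      ((c ⊖ d) ⊕ b) ⊕ d      ≡⟨ ⊕-assoc (c ⊖ d) b d ⟩
      (c ⊖ d) ⊕ (b ⊕ d)      ≡⟨ cong ((c ⊖ d) ⊕_) (⊕-comm b d) ⟩
      (c ⊖ d) ⊕ (d ⊕ b)      ≡⟨ ⊕-assoc (c ⊖ d) d b ⟨
      ((c ⊖ d) ⊕ d) ⊕ b      ≡⟨ cong (_⊕ b) (⊖-⊕ c d) ⟩
      c ⊕ b                  ∎
      where open ≡-Reasoning

    -- Congruence is expressed by multiples of n added on both sides, so that it can be read as an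
    -- identity between exponents of θ. Crossing the two quotients makes each side the common
    -- remainder plus both multiples.
    []-≡⇒ : ∀ a b → [ a ] ≡ [ b ] → ∃₂ λ t t′ → a ℕ.+ n ℕ.* t ≡ b ℕ.+ n ℕ.* t′
    []-≡⇒ a b eq = b / n , a / n , (begin
      a ℕ.+ n ℕ.* (b / n)                           ≡⟨ cong (ℕ._+ n ℕ.* (b / n)) (m≡m%n+[m/n]*n a n) ⟩
      a % n ℕ.+ a / n ℕ.* n ℕ.+ n ℕ.* (b / n)       ≡⟨ cong (λ r → r ℕ.+ a / n ℕ.* n ℕ.+ n ℕ.* (b / n)) ([]-injective-% a b eq) ⟩
      b % n ℕ.+ a / n ℕ.* n ℕ.+ n ℕ.* (b / n)       ≡⟨ swap (b % n) (a / n) (b / n) n ⟩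
      b % n ℕ.+ b / n ℕ.* n ℕ.+ n ℕ.* (a / n)       ≡⟨ cong (ℕ._+ n ℕ.* (a / n)) (m≡m%n+[m/n]*n b n) ⟨
      b ℕ.+ n ℕ.* (a / n)                           ∎)
      where
      open ≡-Reasoning
      open import Data.Nat.Solver
      open +-*-Solver
      swap : ∀ r x y k → r ℕ.+ x ℕ.* k ℕ.+ k ℕ.* y ≡ r ℕ.+ y ℕ.* k ℕ.+ k ℕ.* x
      swap = solve 4 (λ r x y k → r :+ x :* k :+ k :* y := r :+ y :* k :+ k :* x) refl

-- The group ring R[X]/(Xᴺ - 1) of a cyclic group

module GroupRing where
  open import Defs using (_⊕_; _⊖_)
  open Residues
  open import Algebra.Bundles using (CommutativeRing)
  open import Data.Fin.Base using (Fin; zero; suc; punchIn)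
  open import Data.Fin.Properties using (_≟_; punchInᵢ≢i)
  open import Data.Fin.Permutation using (Permutation′; permutation)
  open import Data.Nat.Base as ℕ using (ℕ; suc)
  import Data.Nat.Properties as ℕ
  open import Data.Product using (_,_)
  open import Function.Base using (_∘_)
  open import Level using (0ℓ)
  open import Relation.Binary.PropositionalEquality as ≡ using (_≡_; _≢_)
  open import Relation.Nullary using (yes; no; contradiction)

  module _ (R : CommutativeRing 0ℓ 0ℓ) (m : ℕ) where

    private
      N = suc m
      module R = CommutativeRing R
      module G = Modulo m

    open R using (_≈_) renaming (Carrier to C)
    open import Algebra.Properties.Semiring.Sum R.semiring
    import Relation.Binary.Reasoning.Setoid R.setoid as ≈-Reasoning

    sum-single : ∀ {k} (t : Fin (suc k) → C) i → (∀ j → j ≢ i → t j ≈ R.0#) → sum t ≈ t i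
    sum-single {k} t i vanish = begin
      sum t                             ≈⟨ sum-remove {i = i} t ⟩
      t i R.+ sum (t ∘ punchIn i)       ≈⟨ R.+-congˡ (sum-cong-≋ (λ j → vanish (punchIn i j) (punchInᵢ≢i i j))) ⟩
      t i R.+ sum {k} (λ _ → R.0#)      ≈⟨ R.+-congˡ (sum-replicate-zero k) ⟩
      t i R.+ R.0#                      ≈⟨ R.+-identityʳ (t i) ⟩
      t i                               ∎
      where open ≈-Reasoning

    private
      ⊖-cancel : ∀ (k i : Fin N) → k ⊖ (k ⊖ i) ≡ i
      ⊖-cancel k i = ≡.trans (≡.cong (_⊖ (k ⊖ i)) (≡.sym (≡.trans (G.⊕-comm i _) (G.⊖-⊕ k i)))) (G.⊕-⊖ i (k ⊖ i))

      ⊖-⊕-assoc : ∀ (k i j : Fin N) → k ⊖ (i ⊕ j) ≡ (k ⊖ j) ⊖ i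
      ⊖-⊕-assoc k i j = G.⊕-cancelʳ (i ⊕ j) _ _ (≡.trans (G.⊖-⊕ k (i ⊕ j)) (≡.sym
        (≡.trans (≡.sym (G.⊕-assoc ((k ⊖ j) ⊖ i) i j)) (≡.trans (≡.cong (_⊕ j) (G.⊖-⊕ (k ⊖ j) i)) (G.⊖-⊕ k j)))))

      reflection : Fin N → Permutation′ N
      reflection k = permutation (k ⊖_) (k ⊖_) (⊖-cancel k) (⊖-cancel k)

      translation : Fin N → Permutation′ N
      translation j = permutation (_⊕ j) (_⊖ j) (λ i → G.⊖-⊕ i j) (λ i → G.⊕-⊖ i j)

    -- A function f stands for the class of the polynomial whose coefficient at Xᵏ is `f k`; the
    -- convolution `_⋆_` is then multiplication modulo Xᴺ - 1.
    Elt : Set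
    Elt = Fin N → C

    infix 4 _≋_
    _≋_ : Elt → Elt → Set
    f ≋ g = ∀ k → f k ≈ g k

    infixl 7 _⋆_
    _⋆_ : Elt → Elt → Elt
    (f ⋆ g) k = ∑[ i < N ] (f i R.* g (k ⊖ i))

    single : Fin N → C → Elt
    single i α j with j ≟ i
    ... | yes _ = α
    ... | no  _ = R.0#

    single-≡ : ∀ i {α} → single i α i ≈ α
    single-≡ i with i ≟ i
    ... | yes _   = R.refl
    ... | no  i≢i = contradiction ≡.refl i≢i

    single-≢ : ∀ {i j} α → j ≢ i → single i α j ≈ R.0#
    single-≢ {i} {j} α j≢i with j ≟ i
    ... | yes j≡i = contradiction j≡i j≢i
    ... | no  _   = R.refl

    single-⋆ : ∀ i α f k → (single i α ⋆ f) k ≈ α R.* f (k ⊖ i)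
    single-⋆ i α f k = R.trans
      (sum-single _ i (λ j j≢i → R.trans (R.*-congʳ (single-≢ α j≢i)) (R.zeroˡ (f (k ⊖ j)))))
      (R.*-congʳ {f (k ⊖ i)} (single-≡ i))

    1ᴳ : Elt
    1ᴳ = single G.[ 0 ] R.1#

    ⊖-identityʳ : ∀ (k : Fin N) → k ⊖ G.[ 0 ] ≡ k
    ⊖-identityʳ k = ≡.trans (≡.cong (_⊖ G.[ 0 ]) (≡.sym (≡.trans (G.⊕-comm k _) (G.⊕-identityˡ k)))) (G.⊕-⊖ k G.[ 0 ])

    ⋆-identityˡ : ∀ f → 1ᴳ ⋆ f ≋ f
    ⋆-identityˡ f k = R.trans (single-⋆ G.[ 0 ] R.1# f k)
      (R.trans (R.*-identityˡ _) (R.reflexive (≡.cong f (⊖-identityʳ k))))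

    ⋆-cong : ∀ {f f′ g g′} → f ≋ f′ → g ≋ g′ → f ⋆ g ≋ f′ ⋆ g′
    ⋆-cong f≋ g≋ k = sum-cong-≋ (λ i → R.*-cong (f≋ i) (g≋ (k ⊖ i)))

    -- The substitution of k - i for i exchanges the arguments of f and g in each summand.
    ⋆-comm : ∀ f g → f ⋆ g ≋ g ⋆ f
    ⋆-comm f g k = begin
      ∑[ i < N ] (f i R.* g (k ⊖ i))                 ≈⟨ ∑-permute (λ i → f i R.* g (k ⊖ i)) (reflection k) ⟩
      ∑[ i < N ] (f (k ⊖ i) R.* g (k ⊖ (k ⊖ i)))     ≈⟨ sum-cong-≋ (λ i → R.trans
        (R.*-congˡ {f (k ⊖ i)} (R.reflexive (≡.cong g (⊖-cancel k i)))) (R.*-comm _ _)) ⟩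
      ∑[ i < N ] (g i R.* f (k ⊖ i))                 ∎
      where open ≈-Reasoning

    ⋆-assoc : ∀ f g h → (f ⋆ g) ⋆ h ≋ f ⋆ (g ⋆ h)
    ⋆-assoc f g h k = begin
      ∑[ i < N ] (∑[ j < N ] (f j R.* g (i ⊖ j)) R.* h (k ⊖ i))
        ≈⟨ sum-cong-≋ (λ i → *-distribʳ-sum (h (k ⊖ i)) (λ j → f j R.* g (i ⊖ j))) ⟩
      ∑[ i < N ] ∑[ j < N ] (f j R.* g (i ⊖ j) R.* h (k ⊖ i))
        ≈⟨ ∑-comm (λ i j → f j R.* g (i ⊖ j) R.* h (k ⊖ i)) ⟩
      ∑[ j < N ] ∑[ i < N ] (f j R.* g (i ⊖ j) R.* h (k ⊖ i))
        ≈⟨ sum-cong-≋ (λ j → begin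
          ∑[ i < N ] (f j R.* g (i ⊖ j) R.* h (k ⊖ i))
            ≈⟨ sum-cong-≋ (λ i → R.*-assoc (f j) (g (i ⊖ j)) (h (k ⊖ i))) ⟩
          ∑[ i < N ] (f j R.* (g (i ⊖ j) R.* h (k ⊖ i)))
            ≈⟨ *-distribˡ-sum (f j) (λ i → g (i ⊖ j) R.* h (k ⊖ i)) ⟨
          f j R.* ∑[ i < N ] (g (i ⊖ j) R.* h (k ⊖ i))
            -- Translating the inner index by j removes the shift from g and moves it to h.
            ≈⟨ R.*-congˡ (∑-permute (λ i → g (i ⊖ j) R.* h (k ⊖ i)) (translation j)) ⟩
          f j R.* ∑[ i < N ] (g ((i ⊕ j) ⊖ j) R.* h (k ⊖ (i ⊕ j)))
            ≈⟨ R.*-congˡ (sum-cong-≋ (λ i → R.reflexive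
                 (≡.cong₂ (λ u v → g u R.* h v) (G.⊕-⊖ i j) (⊖-⊕-assoc k i j)))) ⟩
          f j R.* ∑[ i < N ] (g i R.* h ((k ⊖ j) ⊖ i)) ∎) ⟩
      ∑[ j < N ] (f j R.* ∑[ i < N ] (g i R.* h ((k ⊖ j) ⊖ i))) ∎
      where open ≈-Reasoning

    ⋆-distribˡ : ∀ f g h → f ⋆ (λ k → g k R.+ h k) ≋ λ k → (f ⋆ g) k R.+ (f ⋆ h) k
    ⋆-distribˡ f g h k = R.trans
      (sum-cong-≋ (λ i → R.distribˡ (f i) (g (k ⊖ i)) (h (k ⊖ i))))
      (∑-distrib-+ (λ i → f i R.* g (k ⊖ i)) (λ i → f i R.* h (k ⊖ i)))

    groupRing : CommutativeRing 0ℓ 0ℓ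
    groupRing = record
      { Carrier = Elt ; _≈_ = _≋_ ; _+_ = λ f g k → f k R.+ g k ; _*_ = _⋆_
      ; -_ = λ f k → R.- f k ; 0# = λ _ → R.0# ; 1# = 1ᴳ
      ; isCommutativeRing = record
        { isRing = record
          { +-isAbelianGroup = record
            { isGroup = record
              { isMonoid = record
                { isSemigroup = record
                  { isMagma = record
                    { isEquivalence = record
                      { refl  = λ _ → R.refl
                      ; sym   = λ p k → R.sym (p k)
                      ; trans = λ p q k → R.trans (p k) (q k) }
                    ; ∙-cong = λ p q k → R.+-cong (p k) (q k) }
                  ; assoc = λ f g h k → R.+-assoc (f k) (g k) (h k) }
                ; identity = (λ f k → R.+-identityˡ (f k)) , (λ f k → R.+-identityʳ (f k)) }
              ; inverse = (λ f k → R.-‿inverseˡ (f k)) , (λ f k → R.-‿inverseʳ (f k))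
              ; ⁻¹-cong = λ p k → R.-‿cong (p k) }
            ; comm = λ f g k → R.+-comm (f k) (g k) }
          ; *-cong = λ {f} {f′} {g} {g′} → ⋆-cong {f} {f′} {g} {g′}
          ; *-assoc = ⋆-assoc
          ; *-identity = ⋆-identityˡ , λ f k → R.trans (⋆-comm f 1ᴳ k) (⋆-identityˡ f k)
          ; distrib = ⋆-distribˡ , λ f g h k → R.trans (⋆-comm (λ i → g i R.+ h i) f k)
              (R.trans (⋆-distribˡ f g h k) (R.+-cong (⋆-comm f g k) (⋆-comm f h k))) }
        ; *-comm = ⋆-comm } }

    open import Algebra.Properties.Semiring.Exp (CommutativeRing.semiring groupRing) using (_^_)

    X^ : ℕ → Elt
    X^ t = single G.[ t ] R.1#

    X^-cong : ∀ s t → G.[ s ] ≡ G.[ t ] → X^ s ≋ X^ t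
    X^-cong s t eq k = R.reflexive (≡.cong (λ i → single i R.1# k) eq)

    -- Multiplication by Xˢ shifts coefficients by s, and k - s is the class of t exactly when k is
    -- the class of s + t; so the two mixed cases are contradictory.
    X^-+ : ∀ s t → X^ s ⋆ X^ t ≋ X^ (s ℕ.+ t)
    X^-+ s t k = R.trans (single-⋆ G.[ s ] R.1# (X^ t) k) (R.trans (R.*-identityˡ _) shift)
      where
      shift : X^ t (k ⊖ G.[ s ]) ≈ X^ (s ℕ.+ t) k
      shift with k ⊖ G.[ s ] ≟ G.[ t ] | k ≟ G.[ s ℕ.+ t ]
      ... | yes _ | yes _ = R.refl
      ... | no  _ | no  _ = R.refl
      ... | yes p | no ¬q = contradiction (≡.trans (≡.sym (G.⊖-⊕ k G.[ s ]))
              (≡.trans (≡.cong (_⊕ G.[ s ]) p) (≡.trans (G.⊕-comm _ G.[ s ]) (G.[]-+ s t)))) ¬q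
      ... | no ¬p | yes q = contradiction (G.⊕-cancelʳ G.[ s ] _ _ (≡.trans (G.⊖-⊕ k G.[ s ])
              (≡.trans q (≡.sym (≡.trans (G.⊕-comm G.[ t ] _) (G.[]-+ s t)))))) ¬p

    X^-* : ∀ s t → X^ s ^ t ≋ X^ (s ℕ.* t)
    X^-* s ℕ.zero    = X^-cong 0 (s ℕ.* 0) (≡.cong G.[_] (≡.sym (ℕ.*-zeroʳ s)))
    X^-* s (ℕ.suc t) k = R.trans (⋆-cong {f = X^ s} {g = X^ s ^ t} {g′ = X^ (s ℕ.* t)} (λ _ → R.refl) (X^-* s t) k)
      (R.trans (X^-+ s (s ℕ.* t) k) (X^-cong (s ℕ.+ s ℕ.* t) (s ℕ.* suc t) (≡.cong G.[_] (≡.sym (ℕ.*-suc s t))) k))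

    -- Multiplication by 1 - Xᵈ read off coefficient by coefficient, which allows the support of the
    -- detecting product to be followed.
    ⋆-1-X^ : ∀ f d k → (f ⋆ (λ i → 1ᴳ i R.+ R.- X^ d i)) k ≈ f k R.+ R.- f (k ⊖ G.[ d ])
    ⋆-1-X^ f d k = begin
      (f ⋆ (λ i → 1ᴳ i R.+ R.- X^ d i)) k      ≈⟨ A.distribˡ f 1ᴳ (A.- X^ d) k ⟩
      (f ⋆ 1ᴳ) k R.+ (f ⋆ (A.- X^ d)) k        ≈⟨ R.+-cong (A.*-identityʳ f k) (R.sym (AP.-‿distribʳ-* f (X^ d) k)) ⟩
      f k R.+ R.- (f ⋆ X^ d) k                 ≈⟨ R.+-congˡ (R.-‿cong (R.trans (⋆-comm f (X^ d) k)
                                                    (R.trans (single-⋆ G.[ d ] R.1# f k) (R.*-identityˡ _)))) ⟩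
      f k R.+ R.- f (k ⊖ G.[ d ])              ∎
      where
      open ≈-Reasoning
      module A = CommutativeRing groupRing
      module AP where open import Algebra.Properties.Ring A.ring public

-- The Frobenius map and the identity aᴺ⁺¹ = a

module Frobenius where
  open Residues
  open GroupRing
  open import Algebra.Bundles using (CommutativeRing)
  open import Data.Fin.Base using (Fin; zero; suc; toℕ; inject₁; fromℕ)
  open import Data.Fin.Properties using (toℕ<n; toℕ-inject₁; toℕ-fromℕ)
  open import Data.Nat.Base as ℕ using (ℕ; zero; suc; _<_; _∸_; _!)
  import Data.Nat.Properties as ℕ
  open import Data.Nat.Combinatorics using (_C_; nCn≡1; nCk≡n!/k![n-k]!; k![n∸k]!∣n!)
  open import Data.Nat.Divisibility
  open import Data.Nat.DivMod using (m*[n/m]≡n; m*n%n≡0)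
  open import Data.Nat.Primality using (Prime; euclidsLemma; prime⇒nonTrivial)
  open import Data.Sum.Base using (inj₁; inj₂)
  open import Function.Base using (_∘_)
  open import Level using (0ℓ)
  open import Relation.Binary.PropositionalEquality as ≡ using (_≡_; _≢_)
  open import Relation.Nullary using (¬_; contradiction)

  prime∤1 : ∀ {p} → Prime p → ¬ p ∣ 1
  prime∤1 pr p∣1 = ℕ.<⇒≢ (ℕ.nonTrivial⇒n>1 _ {{prime⇒nonTrivial pr}}) (≡.sym (∣1⇒≡1 p∣1))

  prime∤! : ∀ {p} → Prime p → ∀ k → k < p → ¬ p ∣ k !
  prime∤! pr zero    _   p∣ = prime∤1 pr p∣
  prime∤! pr (suc k) k<p p∣ with euclidsLemma (suc k) (k !) pr p∣
  ... | inj₁ d = ℕ.<⇒≱ k<p (∣⇒≤ d)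
  ... | inj₂ d = prime∤! pr k (ℕ.<-trans (ℕ.n<1+n k) k<p) d

  -- The product of k!, (p - k)! and the binomial coefficient is p!, which p divides, while p
  -- divides neither factorial because k and p - k are below p.
  prime∣C : ∀ {p} → Prime p → ∀ k → 0 < k → k < p → p ∣ p C k
  prime∣C {p@(suc p′)} pr k 0<k k<p
    with euclidsLemma (k ! ℕ.* (p ∸ k) !) (p C k) pr (≡.subst (p ∣_) (≡.sym k![p-k]!C≡p!) (m∣m*n (p′ !)))
    where
    instance
      _ = ℕ._!*_!≢0 k (p ∸ k)
    k![p-k]!C≡p! : k ! ℕ.* (p ∸ k) ! ℕ.* (p C k) ≡ p !
    k![p-k]!C≡p! = ≡.trans (≡.cong (k ! ℕ.* (p ∸ k) ! ℕ.*_) (nCk≡n!/k![n-k]! (ℕ.<⇒≤ k<p)))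
      (m*[n/m]≡n (k![n∸k]!∣n! (ℕ.<⇒≤ k<p)))
  ... | inj₂ d = d
  ... | inj₁ d with euclidsLemma (k !) ((p ∸ k) !) pr d
  ...   | inj₁ e = contradiction e (prime∤! pr k k<p)
  ...   | inj₂ e = contradiction e (prime∤! pr (p ∸ k) (ℕ.∸-monoʳ-< 0<k (ℕ.<⇒≤ k<p)))

  module _ (A : CommutativeRing 0ℓ 0ℓ) where

    open CommutativeRing A hiding (zero)
    open import Algebra.Properties.Semiring.Exp semiring
    open import Algebra.Properties.CommutativeSemiring.Exp commutativeSemiring using ()
    open import Algebra.Properties.Semiring.Mult semiring
    open import Algebra.Properties.Semiring.Sum semiring
    open import Algebra.Properties.CommutativeSemiring.Binomial commutativeSemiring
      using (binomialTerm) renaming (theorem to binomialTheorem)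
    open import Relation.Binary.Reasoning.Setoid setoid

    module _ {p′} (pr : Prime (suc p′)) (p×≈0 : ∀ x → suc p′ × x ≈ 0#) where

      private
        p = suc p′

      ∣-× : ∀ {n} x → p ∣ n → n × x ≈ 0#
      ∣-× {n} x (divides m eq) = begin
        n × x            ≈⟨ ×-congˡ (≡.trans eq (ℕ.*-comm m p)) ⟩
        (p ℕ.* m) × x    ≈⟨ ×-assocˡ x p m ⟨
        p × (m × x)      ≈⟨ p×≈0 _ ⟩
        0#               ∎

      -- Only the two extreme terms of the binomial expansion survive: p divides every other
      -- coefficient and annihilates the ring.
      frobenius-+ : ∀ x y → (x + y) ^ p ≈ x ^ p + y ^ p
      frobenius-+ x y = begin
        (x + y) ^ suc p′                                        ≈⟨ binomialTheorem (suc p′) x y ⟩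
        t zero + sum (t ∘ suc)                                  ≈⟨ +-congˡ (sum-init-last (t ∘ suc)) ⟩
        t zero + (sum (t ∘ suc ∘ inject₁) + t (suc (fromℕ p′)))
          ≈⟨ +-cong first (+-cong (trans (sum-cong-≋ middle) (sum-replicate-zero p′)) last) ⟩
        y ^ suc p′ + (0# + x ^ suc p′)                          ≈⟨ +-congˡ (+-identityˡ _) ⟩
        y ^ suc p′ + x ^ suc p′                                 ≈⟨ +-comm _ _ ⟩
        x ^ suc p′ + y ^ suc p′                                 ∎
        where
        t = binomialTerm x y (suc p′)
        first : t zero ≈ y ^ suc p′
        first = trans (×-homo-1 _) (*-identityˡ _)
        last : t (suc (fromℕ p′)) ≈ x ^ suc p′
        last rewrite toℕ-fromℕ p′ | nCn≡1 (suc p′) | ℕ.n∸n≡0 p′ = trans (×-homo-1 _) (*-identityʳ _)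
        middle : ∀ i → t (suc (inject₁ i)) ≈ 0#
        -- The index is 1 + i with i < p - 1, hence strictly between 0 and p.
        middle i = ∣-× _ (prime∣C pr _ (ℕ.s≤s ℕ.z≤n) (ℕ.s≤s (≡.subst (_< p′) (≡.sym (toℕ-inject₁ i)) (toℕ<n i))))

      frobenius^-+ : ∀ k x y → (x + y) ^ (p ℕ.^ k) ≈ x ^ (p ℕ.^ k) + y ^ (p ℕ.^ k)
      frobenius^-+ zero    x y = trans (*-identityʳ _) (sym (+-cong (*-identityʳ _) (*-identityʳ _)))
      frobenius^-+ (suc k) x y = begin
        (x + y) ^ (p ℕ.* p ℕ.^ k)                           ≈⟨ ^-assocʳ (x + y) p (p ℕ.^ k) ⟨
        ((x + y) ^ p) ^ (p ℕ.^ k)                           ≈⟨ ^-congˡ (p ℕ.^ k) (frobenius-+ x y) ⟩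
        (x ^ p + y ^ p) ^ (p ℕ.^ k)                         ≈⟨ frobenius^-+ k (x ^ p) (y ^ p) ⟩
        (x ^ p) ^ (p ℕ.^ k) + (y ^ p) ^ (p ℕ.^ k)           ≈⟨ +-cong (^-assocʳ x p (p ℕ.^ k)) (^-assocʳ y p (p ℕ.^ k)) ⟩
        x ^ (p ℕ.* p ℕ.^ k) + y ^ (p ℕ.* p ℕ.^ k)           ∎

  -- 𝔽ₚ[X]/(Xᴺ - 1) with N = suc m and p = suc p′.
  module CyclicAlgebra (p′ : ℕ) (m : ℕ) where

    private
      p = suc p′
      N = suc m

    module 𝔽 = Modulo p′
    module G = Modulo m

    A : CommutativeRing 0ℓ 0ℓ
    A = groupRing 𝔽.ℤ/ m

    private
      module F = CommutativeRing 𝔽.ℤ/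
      module ΣF where open import Algebra.Properties.Semiring.Sum F.semiring public
      module ΠF where open import Algebra.Properties.Semiring.Mult F.semiring public

    open CommutativeRing A hiding (zero)
    open import Algebra.Properties.Semiring.Exp semiring
    open import Algebra.Properties.Semiring.Mult semiring
    open import Algebra.Properties.Semiring.Sum semiring

    ×-[] : ∀ n a → n ΠF.× 𝔽.[ a ] ≡ 𝔽.[ n ℕ.* a ]
    ×-[] zero    a = ≡.refl
    ×-[] (suc n) a = ≡.trans (≡.cong (𝔽.[ a ] F.+_) (×-[] n a)) (𝔽.[]-+ a (n ℕ.* a))

    ×-at : ∀ n f k → (n × f) k ≡ n ΠF.× f k
    ×-at zero    f k = ≡.refl
    ×-at (suc n) f k = ≡.cong (f k F.+_) (×-at n f k)

    sum-at : ∀ {n} (f : Fin n → Carrier) k → sum f k ≡ ΣF.sum (λ i → f i k)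
    sum-at {zero}  f k = ≡.refl
    sum-at {suc n} f k = ≡.cong (f zero k F.+_) (sum-at (f ∘ suc) k)

    p×≈0 : ∀ x → p × x ≈ 0#
    p×≈0 x k = ≡.trans (×-at p x k) (≡.trans (≡.cong (p ΠF.×_) (≡.sym (𝔽.[toℕ] (x k)))) (≡.trans (×-[] p (toℕ (x k)))
      (𝔽.[]-cong-% (p ℕ.* toℕ (x k)) 0 (≡.trans (≡.cong (ℕ._% p) (ℕ.*-comm p (toℕ (x k)))) (m*n%n≡0 (toℕ (x k)) p)))))

    -- Coefficients enter as natural multiples of monomials, so closure under addition is enough to
    -- carry a property from the monomials to all elements.
    expand : ∀ a → a ≈ ∑[ i < N ] (toℕ (a i) × X^ 𝔽.ℤ/ m (toℕ i))
    expand a k = ≡.sym (≡.trans (sum-at t k) (≡.trans (sum-single 𝔽.ℤ/ m (λ i → t i k) k off) on))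
      where
      t : Fin N → Carrier
      t i = toℕ (a i) × X^ 𝔽.ℤ/ m (toℕ i)
      on : t k k ≡ a k
      on = ≡.trans (×-at (toℕ (a k)) _ k) (≡.trans (≡.cong (toℕ (a k) ΠF.×_)
            (≡.trans (≡.cong (λ i → single 𝔽.ℤ/ m i F.1# k) (G.[toℕ] k)) (single-≡ 𝔽.ℤ/ m k)))
          (≡.trans (×-[] (toℕ (a k)) 1) (≡.trans (≡.cong 𝔽.[_] (ℕ.*-identityʳ (toℕ (a k)))) (𝔽.[toℕ] (a k)))))
      off : ∀ i → i ≢ k → t i k ≡ F.0#
      off i i≢k = ≡.trans (×-at (toℕ (a i)) _ k) (≡.trans (≡.cong (toℕ (a i) ΠF.×_)
            (single-≢ 𝔽.ℤ/ m F.1# (λ k≡ → i≢k (≡.sym (≡.trans k≡ (G.[toℕ] i))))))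
          (≡.trans (×-[] (toℕ (a i)) 0) (≡.cong 𝔽.[_] (ℕ.*-zeroʳ (toℕ (a i))))))

    module _ (pr : Prime p) (k : ℕ) (p^k≡1+N : p ℕ.^ k ≡ suc N) where

      ^-+ : ∀ x y → (x + y) ^ suc N ≈ x ^ suc N + y ^ suc N
      ^-+ = ≡.subst (λ Q → ∀ x y → (x + y) ^ Q ≈ x ^ Q + y ^ Q) p^k≡1+N (frobenius^-+ A pr p×≈0 k)

      Fixed : Carrier → Set
      Fixed x = x ^ suc N ≈ x

      0-fixed : Fixed 0#
      0-fixed = zeroˡ (0# ^ N)

      +-fixed : ∀ {x y} → Fixed x → Fixed y → Fixed (x + y)
      +-fixed {x} {y} fx fy = trans (^-+ x y) (+-cong {x ^ suc N} {x} {y ^ suc N} {y} fx fy)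

      ×-fixed : ∀ n {x} → Fixed x → Fixed (n × x)
      ×-fixed zero    fx = 0-fixed
      ×-fixed (suc n) {x} fx = +-fixed {x} {n × x} fx (×-fixed n {x} fx)

      sum-fixed : ∀ {n} (f : Fin n → Carrier) → (∀ i → Fixed (f i)) → Fixed (sum f)
      sum-fixed {zero}  f fx = 0-fixed
      sum-fixed {suc n} f fx = +-fixed {f zero} {sum (f ∘ suc)} (fx zero) (sum-fixed (f ∘ suc) (fx ∘ suc))

      -- Exponents of X count modulo N, and t (N + 1) is congruent to t.
      X^-fixed : ∀ t → Fixed (X^ 𝔽.ℤ/ m t)
      X^-fixed t = trans (X^-* 𝔽.ℤ/ m t (suc N)) (X^-cong 𝔽.ℤ/ m (t ℕ.* suc N) t (G.[]-cong-% (t ℕ.* suc N) t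
        (≡.trans (≡.cong (ℕ._% N) (ℕ.*-suc t N)) ([m+kn]%n≡m%n t t N))))
        where open import Data.Nat.DivMod

      -- The map x ↦ xᴺ⁺¹ is an iterate of the Frobenius map, hence additive; it fixes every
      -- monomial and therefore every sum of monomials.
      all-fixed : ∀ a → a ^ suc N ≈ a
      all-fixed a = trans (^-congˡ (suc N) (expand a)) (trans (sum-fixed t (λ i → ×-fixed (toℕ (a i)) (X^-fixed (toℕ i)))) (sym (expand a)))
        where
        t : Fin N → Carrier
        t i = toℕ (a i) × X^ 𝔽.ℤ/ m (toℕ i)

-- Passage to a field with an element of order N

module Semisimple where
  open import Defs using (_⊕_; _⊖_)
  open Residues
  open GroupRing
  open Frobenius
  open import Algebra.Bundles using (CommutativeRing)
  open import Data.Fin.Base using (Fin; zero; suc; finToFun; funToFin)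
  open import Data.Fin.Properties using (finToFun-funToFin; all?) renaming (_≟_ to _≟ᶠ_)
  open import Data.List.Base using ([]; _∷_)
  open import Data.List.Relation.Unary.All using (_∷_)
  open import Data.Nat.Base as ℕ using (ℕ; zero; suc; _<_; _≤_; s≤s)
  import Data.Nat.Properties as ℕ
  open import Data.Nat.DivMod using (m*n%n≡0; n%n≡0)
  open import Data.Nat.Divisibility
  open import Data.Nat.GCD
  open import Data.Nat.Primality using (Prime; prime?; euclidsLemma; prime⇒nonTrivial; prime⇒nonZero)
  open import Data.Nat.Primality.Factorisation using (factorise; PrimeFactorisation)
  open import Data.Product using (Σ-syntax; ∃-syntax; _×_; _,_)
  open import Data.Sum.Base as Sum using (_⊎_; inj₁; inj₂)
  open import Function.Base using (_∘_; case_of_)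
  open import Level using (0ℓ)
  open import Relation.Binary.Definitions using (Decidable)
  open import Relation.Binary.PropositionalEquality as ≡ using (_≡_; _≢_)
  open import Relation.Nullary using (¬_; yes; no; contradiction)
  open import Relation.Nullary.Decidable using (_×-dec_)

  module _ (A : CommutativeRing 0ℓ 0ℓ) where

    open CommutativeRing A hiding (zero)

    -- The quotient of A by the annihilator of e
    module Quotient (e : Carrier) where

      infix 4 _∼_
      _∼_ : Carrier → Carrier → Set
      x ∼ y = e * x ≈ e * y

      ≈⇒∼ : ∀ {x y} → x ≈ y → x ∼ y
      ≈⇒∼ = *-congˡ

      private
        swap : ∀ x y → e * (x * y) ≈ (e * y) * x
        swap x y = trans (*-congˡ (*-comm x y)) (sym (*-assoc e y x))

        *-∼ : ∀ {x x′ y y′} → x ∼ x′ → y ∼ y′ → x * y ∼ x′ * y′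
        *-∼ {x} {x′} {y} {y′} p q = trans (sym (*-assoc e x y)) (trans (*-congʳ p)
          (trans (*-assoc e x′ y) (trans (swap x′ y) (trans (*-congʳ q) (sym (swap x′ y′))))))

        neg-∼ : ∀ {x y} → x ∼ y → - x ∼ - y
        neg-∼ {x} {y} p = trans (sym (-‿distribʳ-* e x)) (trans (-‿cong p) (-‿distribʳ-* e y))
          where open import Algebra.Properties.Ring ring

      quotientRing : CommutativeRing 0ℓ 0ℓ
      quotientRing = record
        { Carrier = Carrier ; _≈_ = _∼_ ; _+_ = _+_ ; _*_ = _*_ ; -_ = -_ ; 0# = 0# ; 1# = 1#
        ; isCommutativeRing = record
          { isRing = record
            { +-isAbelianGroup = record
              { isGroup = record
                { isMonoid = record
                  { isSemigroup = record
                    { isMagma = record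
                      { isEquivalence = record { refl = refl ; sym = sym ; trans = trans }
                      ; ∙-cong = λ {x} {x′} {y} {y′} p q → trans (distribˡ e x y) (trans (+-cong p q) (sym (distribˡ e x′ y′))) }
                    ; assoc = λ x y z → ≈⇒∼ (+-assoc x y z) }
                  ; identity = (λ x → ≈⇒∼ (+-identityˡ x)) , (λ x → ≈⇒∼ (+-identityʳ x)) }
                ; inverse = (λ x → ≈⇒∼ (-‿inverseˡ x)) , (λ x → ≈⇒∼ (-‿inverseʳ x))
                ; ⁻¹-cong = neg-∼ }
              ; comm = λ x y → ≈⇒∼ (+-comm x y) }
            ; *-cong = *-∼
            ; *-assoc = λ x y z → ≈⇒∼ (*-assoc x y z)
            ; *-identity = (λ x → ≈⇒∼ (*-identityˡ x)) , (λ x → ≈⇒∼ (*-identityʳ x))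
            ; distrib = (λ x y z → ≈⇒∼ (distribˡ x y z)) , (λ x y z → ≈⇒∼ (distribʳ x y z)) }
          ; *-comm = λ x y → ≈⇒∼ (*-comm x y) } }

      -- _^_ and _×_ take the equality of the ring as a parameter, so these are not definitional.
      private
        module Qᵉ where open import Algebra.Properties.Semiring.Exp (CommutativeRing.semiring quotientRing) public
        module Qᵐ where open import Algebra.Properties.Semiring.Mult (CommutativeRing.semiring quotientRing) public
        module Aᵉ where open import Algebra.Properties.Semiring.Exp semiring public
        module Aᵐ where open import Algebra.Properties.Semiring.Mult semiring public

      ^-quotient : ∀ x n → x Qᵉ.^ n ≡ x Aᵉ.^ n
      ^-quotient x zero    = ≡.refl
      ^-quotient x (suc n) = ≡.cong (x *_) (^-quotient x n)

      ×-quotient : ∀ n x → n Qᵐ.× x ≡ n Aᵐ.× x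
      ×-quotient zero    x = ≡.refl
      ×-quotient (suc n) x = ≡.cong (x +_) (×-quotient n x)

    open import Algebra.Properties.Semiring.Exp semiring
    open import Relation.Binary.Reasoning.Setoid setoid

    -- The alternatives say that in the quotient by the annihilator of e the element a is zero, or
    -- has b as an inverse.
    ZeroOrInvertible : Carrier → Carrier → Set
    ZeroOrInvertible e a = e * a ≈ 0# ⊎ ∃[ b ] e * (a * b) ≈ e

    module _ (_≟_ : Decidable _≈_) (m : ℕ) (power : ∀ a → a ^ suc (suc m) ≈ a) where

      -- If e a ≈ 0 there is nothing to do; otherwise replace e by e a, on which a has the inverse aᵐ.
      zeroOrInvertible : ∀ {k} (g : Fin k → Carrier) u → ¬ u ≈ 0# →
        ∃[ w ] ¬ u * w ≈ 0# × ∀ i → ZeroOrInvertible (u * w) (g i)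
      zeroOrInvertible {zero}  g u u≉0 = 1# , (λ eq → u≉0 (trans (sym (*-identityʳ u)) eq)) , λ ()
      zeroOrInvertible {suc k} g u u≉0 with zeroOrInvertible (g ∘ suc) u u≉0
      ... | w , e≉0 , inv with ((u * w) * g zero) ≟ 0#
      ...   | yes ea≈0 = w , e≉0 , λ { zero → inj₁ ea≈0 ; (suc i) → inv i }
      ...   | no  ea≉0 = w * a , (λ eq → ea≉0 (trans (sym e′≈) eq)) , λ
        { zero    → inj₂ (a ^ m , (begin
            (u * (w * a)) * (a * a ^ m)   ≈⟨ *-congʳ e′≈ ⟩
            (e * a) * (a ^ suc m)         ≈⟨ *-assoc e a _ ⟩
            e * a ^ suc (suc m)           ≈⟨ *-congˡ (power a) ⟩
            e * a                         ≈⟨ e′≈ ⟨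
            u * (w * a)                   ∎))
        ; (suc i) → Sum.map (mult (g (suc i))) (λ { (b , eq) → b , mult₂ eq }) (inv i) }
        where
        a = g zero
        e = u * w
        e′≈ : u * (w * a) ≈ e * a
        e′≈ = sym (*-assoc u w a)
        e′* : ∀ x → (u * (w * a)) * x ≈ (e * x) * a
        e′* x = trans (*-congʳ e′≈) (trans (*-assoc e a x) (trans (*-congˡ (*-comm a x)) (sym (*-assoc e x a))))
        mult : ∀ x → e * x ≈ 0# → (u * (w * a)) * x ≈ 0#
        mult x ex≈0 = trans (e′* x) (trans (*-congʳ ex≈0) (zeroˡ a))
        mult₂ : ∀ {x} → e * x ≈ e → (u * (w * a)) * x ≈ u * (w * a)
        mult₂ {x} eq = trans (e′* x) (trans (*-congʳ eq) (sym e′≈))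

  module Order (K : CommutativeRing 0ℓ 0ℓ) where

    open CommutativeRing K hiding (zero)
    open import Algebra.Properties.Semiring.Exp semiring
    open import Relation.Binary.Reasoning.Setoid setoid

    1^ : ∀ n → 1# ^ n ≈ 1#
    1^ zero    = refl
    1^ (suc n) = trans (*-identityˡ _) (1^ n)

    ^-∣ : ∀ {x m n} → m ∣ n → x ^ m ≈ 1# → x ^ n ≈ 1#
    ^-∣ {x} {m} {n} (divides c eq) p = begin
      x ^ n           ≈⟨ ^-congʳ x (≡.trans eq (ℕ.*-comm c m)) ⟩
      x ^ (m ℕ.* c)   ≈⟨ ^-assocʳ x m c ⟨
      (x ^ m) ^ c     ≈⟨ ^-congˡ c p ⟩
      1# ^ c          ≈⟨ 1^ c ⟩
      1#              ∎

    ^-difference : ∀ {x} d {s t} → d ℕ.+ s ≡ t → x ^ s ≈ 1# → x ^ t ≈ 1# → x ^ d ≈ 1#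
    ^-difference {x} d {s} {t} eq ps pt = begin
      x ^ d               ≈⟨ *-identityʳ _ ⟨
      x ^ d * 1#          ≈⟨ *-congˡ ps ⟨
      x ^ d * x ^ s       ≈⟨ ^-homo-* x d s ⟨
      x ^ (d ℕ.+ s)       ≈⟨ ^-congʳ x eq ⟩
      x ^ t               ≈⟨ pt ⟩
      1#                  ∎

    -- By Bézout the gcd is a difference of a multiple of s and a multiple of t; `^-difference` uses
    -- this in additive form, without negative exponents.
    ^-gcd : ∀ {x} s t → x ^ s ≈ 1# → x ^ t ≈ 1# → x ^ gcd s t ≈ 1#
    ^-gcd {x} s t ps pt with Bézout.identity (gcd-GCD s t)
    ... | Bézout.+- a b eq = ^-difference (gcd s t) eq (^-∣ (divides b ≡.refl) pt) (^-∣ (divides a ≡.refl) ps)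
    ... | Bézout.-+ a b eq = ^-difference (gcd s t) eq (^-∣ (divides a ≡.refl) ps) (^-∣ (divides b ≡.refl) pt)

    -- Let g be the gcd of t and N. If N/g had a prime factor l, then g would divide N/l and x^(N/l)
    -- would be 1, which is excluded. Hence g = N, and N divides t.
    order : ∀ N .{{_ : ℕ.NonZero N}} {x} → x ^ N ≈ 1# →
      (∀ l d → Prime l → N ≡ d ℕ.* l → ¬ x ^ d ≈ 1#) → ∀ t → x ^ t ≈ 1# → N ∣ t
    order N {x} xᴺ≈1 maximal t xᵗ≈1 with gcd[m,n]∣n t N
    ... | divides c eq = go (factorise c)
      where
      instance
        c≢0 : ℕ.NonZero c
        c≢0 = ℕ.≢-nonZero λ { ≡.refl → ℕ.≢-nonZero⁻¹ N eq }
      xᵍ≈1 = ^-gcd t N xᵗ≈1 xᴺ≈1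
      go : PrimeFactorisation c → N ∣ t
      go record { factors = [] ; isFactorisation = c≡1 } =
        ≡.subst (_∣ t) (≡.sym (≡.trans eq (≡.trans (≡.cong (ℕ._* gcd t N) c≡1) (ℕ.*-identityˡ _)))) (gcd[m,n]∣m t N)
      go record { factors = l ∷ ls ; isFactorisation = c≡ ; factorsPrime = l-prime ∷ _ } =
        contradiction (^-∣ (divides c′ ≡.refl) xᵍ≈1) (maximal l (c′ ℕ.* gcd t N) l-prime (≡.trans eq
          (≡.trans (≡.cong (ℕ._* gcd t N) c≡) (swap l c′ (gcd t N)))))
        where
        c′ = product ls
          where open import Data.Nat.ListAction
        open import Data.Nat.Solver
        open +-*-Solver
        swap : ∀ a b c → a ℕ.* b ℕ.* c ≡ b ℕ.* c ℕ.* a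
        swap = solve 3 (λ a b c → a :* b :* c := b :* c :* a) ≡.refl

  module _ (K : CommutativeRing 0ℓ 0ℓ) where

    open CommutativeRing K hiding (zero)
    open import Algebra.Properties.Semiring.Exp semiring
    open import Algebra.Properties.Semiring.Mult semiring renaming (_×_ to _×′_)

    -- For Q = N + 1 with N positive this describes a field with Q elements: θ generates the nonzero
    -- ones, and `power` provides inverses as powers.
    record IsSplittingDomain (p N Q : ℕ) : Set where
      field
        _≟_     : Decidable _≈_
        1≉0     : ¬ 1# ≈ 0#
        domain  : ∀ x y → x * y ≈ 0# → x ≈ 0# ⊎ y ≈ 0#
        char    : ∀ x → p ×′ x ≈ 0#
        power   : ∀ x → x ^ Q ≈ x
        θ       : Carrier
        θᴺ≈1    : θ ^ N ≈ 1#
        θ-order : ∀ t → θ ^ t ≈ 1# → N ∣ t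

  -- A commutative ring with x ^ (N + 1) = x for all x, passed to a nonzero quotient that is a field
  -- and in which θ still has order N, because u remains nonzero and is divisible by every 1 - θ^(N/l).
  module _ (A : CommutativeRing 0ℓ 0ℓ) where

    open CommutativeRing A hiding (zero)
    open import Algebra.Properties.Semiring.Exp semiring
    open import Algebra.Properties.Semiring.Mult semiring renaming (_×_ to _×′_)
    open import Algebra.Properties.Ring ring
    open import Relation.Binary.Reasoning.Setoid setoid

    splitting : ∀ p m → let N = suc m in
      Decidable _≈_ → (∀ x → p ×′ x ≈ 0#) → (∀ x → x ^ suc N ≈ x) →
      ∀ {k} (g : Fin k → Carrier) → (∀ x → ∃[ i ] x ≈ g i) →
      ∀ u → ¬ u ≈ 0# → ∀ θ → θ ^ N ≈ 1# →
      (∀ l d → Prime l → N ≡ d ℕ.* l → ∃[ w ] u ≈ (1# + - θ ^ d) * w) →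
      Σ[ K ∈ CommutativeRing 0ℓ 0ℓ ] IsSplittingDomain K p N (suc N)
    splitting p m _≟_ p×≈0 all-fixed g surj u u≉0 θ θᴺ detects
      with zeroOrInvertible A _≟_ m all-fixed g u u≉0
    ... | w , e≉0 , inv = quotientRing , record
      { _≟_ = λ x y → (e * x) ≟ (e * y)
      ; 1≉0 = λ eq → e≉0 (trans (sym (*-identityʳ e)) (trans eq (zeroʳ e)))
      ; domain = domain
      ; char = λ x → ≡.subst (_∼ 0#) (≡.sym (×-quotient p x)) (≈⇒∼ (p×≈0 x))
      ; power = λ x → ≡.subst (_∼ x) (≡.sym (^-quotient x (suc (suc m)))) (≈⇒∼ (all-fixed x))
      ; θ = θ
      ; θᴺ≈1 = θᴺ∼1
      ; θ-order = Order.order quotientRing (suc m) θᴺ∼1 (λ l d l-prime eq θ^d∼1 →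
          maximal l d l-prime eq (≡.subst (_∼ 1#) (^-quotient θ d) θ^d∼1)) }
      where
      e = u * w
      open Quotient A e

      θᴺ∼1 = ≡.subst (_∼ 1#) (≡.sym (^-quotient θ (suc m))) (≈⇒∼ θᴺ)

      zeroOrInv : ∀ x → ZeroOrInvertible A e x
      zeroOrInv x with surj x
      ... | i , x≈ = Sum.map (trans (*-congˡ x≈)) (λ { (b , eq) → b , trans (*-congˡ (*-congʳ x≈)) eq }) (inv i)

      -- A factor x that is nonzero in the quotient has an inverse b there, so y = b x y vanishes
      -- together with x y.
      domain : ∀ x y → x * y ∼ 0# → x ∼ 0# ⊎ y ∼ 0#
      domain x y exy with zeroOrInv x
      ... | inj₁ ex≈0 = inj₁ (trans ex≈0 (sym (zeroʳ e)))
      ... | inj₂ (b , exb≈e) = inj₂ (begin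
        e * y               ≈⟨ *-congʳ exb≈e ⟨
        (e * (x * b)) * y   ≈⟨ *-congʳ (*-congˡ (*-comm x b)) ⟩
        (e * (b * x)) * y   ≈⟨ *-assoc e (b * x) y ⟩
        e * ((b * x) * y)   ≈⟨ *-congˡ (*-assoc b x y) ⟩
        e * (b * (x * y))   ≈⟨ *-congˡ (*-comm b (x * y)) ⟩
        e * ((x * y) * b)   ≈⟨ *-assoc e (x * y) b ⟨
        (e * (x * y)) * b   ≈⟨ *-congʳ exy ⟩
        (e * 0#) * b        ≈⟨ *-congʳ (zeroʳ e) ⟩
        0# * b              ≈⟨ zeroˡ b ⟩
        0#                  ≈⟨ zeroʳ e ⟨
        e * 0#              ∎)

      -- Because x = x² xᵐ, the ring is reduced; this will exclude e² = 0.
      square : ∀ x → x * x ≈ 0# → x ≈ 0#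
      square x x²≈0 = begin
        x                  ≈⟨ all-fixed x ⟨
        x * (x * x ^ m)    ≈⟨ *-assoc x x (x ^ m) ⟨
        (x * x) * x ^ m    ≈⟨ *-congʳ x²≈0 ⟩
        0# * x ^ m         ≈⟨ zeroˡ (x ^ m) ⟩
        0#                 ∎

      -- If θᵈ became 1, then e would annihilate 1 - θᵈ, which divides u and hence e = u w. So e² =
      -- 0 and e = 0, against the choice of e.
      maximal : ∀ l d → Prime l → suc m ≡ d ℕ.* l → ¬ θ ^ d ∼ 1#
      maximal l d l-prime eq θ^d∼1 with v , u≈ ← detects l d l-prime eq =
        e≉0 (square e (begin
          e * (u * w)                           ≈⟨ *-congˡ (*-congʳ u≈) ⟩
          e * (((1# + - θ ^ d) * v) * w)        ≈⟨ *-congˡ (*-assoc (1# + - θ ^ d) v w) ⟩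
          e * ((1# + - θ ^ d) * (v * w))        ≈⟨ *-assoc e (1# + - θ ^ d) (v * w) ⟨
          (e * (1# + - θ ^ d)) * (v * w)        ≈⟨ *-congʳ e[1-θ^d]≈0 ⟩
          0# * (v * w)                          ≈⟨ zeroˡ (v * w) ⟩
          0#                                    ∎))
        where
        e[1-θ^d]≈0 : e * (1# + - θ ^ d) ≈ 0#
        e[1-θ^d]≈0 = begin
          e * (1# + - θ ^ d)            ≈⟨ distribˡ e 1# (- θ ^ d) ⟩
          e * 1# + e * - θ ^ d          ≈⟨ +-cong (sym θ^d∼1) (sym (-‿distribʳ-* e (θ ^ d))) ⟩
          e * θ ^ d + - (e * θ ^ d)     ≈⟨ -‿inverseʳ (e * θ ^ d) ⟩
          0#                            ∎

  module _ (p′ m k : ℕ) (pr : Prime (suc p′)) (p^k≡ : suc p′ ℕ.^ k ≡ suc (suc m)) where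

    private
      p = suc p′
      N = suc m

    open CyclicAlgebra p′ m
    open CommutativeRing A hiding (zero)
    open import Algebra.Properties.Semiring.Exp semiring
    open import Algebra.Properties.Semiring.Mult semiring renaming (_×_ to _×′_)
    open import Relation.Binary.Reasoning.Setoid setoid

    private
      module F = CommutativeRing 𝔽.ℤ/
      module Z = CommutativeRing G.ℤ/

      X = X^ 𝔽.ℤ/ m

      1≢0 : F.1# ≢ F.0#
      1≢0 eq = ℕ.<⇒≢ (ℕ.nonTrivial⇒n>1 p {{prime⇒nonTrivial pr}})
        (≡.sym (∣1⇒≡1 (m%n≡0⇒n∣m 1 p (𝔽.[]-injective-% 1 0 eq))))

      _≟_ : Decidable _≈_
      x ≟ y = all? (λ i → x i ≟ᶠ y i)

      factor : ℕ → Carrier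
      factor d = 1# + - X d

    -- The product of 1 - X^(N/l) over the primes l < b that divide N; its support lies in the
    -- multiples of N/r in ℤ/N, where r is the product of these primes.
    record Detector (b : ℕ) : Set where
      field
        u        : Carrier
        r        : ℕ
        r-coprime : ∀ l → Prime l → b ≤ l → ¬ l ∣ r
        u-at-0   : u G.[ 0 ] ≡ F.1#
        support  : ∀ j → u j ≡ F.0# ⊎ G.[ r ] G.⊗ j ≡ G.[ 0 ]
        detects  : ∀ l d → Prime l → l < b → N ≡ d ℕ.* l → ∃[ w ] u ≈ factor d * w

    -- In the recursion a prime b dividing N contributes the factor 1 - X^(N/b) and multiplies r by
    -- b; any other b leaves the product unchanged.
    detector : ∀ b → Detector b
    detector zero = record
      { u = 1# ; r = 1
      ; r-coprime = λ l l-prime _ → prime∤1 l-prime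
      ; u-at-0 = single-≡ 𝔽.ℤ/ m G.[ 0 ]
      ; support = support
      ; detects = λ _ _ _ () }
      where
      support : ∀ j → 1# j ≡ F.0# ⊎ G.[ 1 ] G.⊗ j ≡ G.[ 0 ]
      support j with j ≟ᶠ G.[ 0 ]
      ... | yes ≡.refl = inj₂ (G.⊗-identityˡ G.[ 0 ])
      ... | no  _      = inj₁ ≡.refl
    detector (suc b) with detector b | prime? b ×-dec (b ∣? N)
    ... | D | no ¬b = record
      { Detector D
      ; r-coprime = λ l l-prime b<l → r-coprime l l-prime (ℕ.<⇒≤ b<l)
      ; detects = λ l d l-prime l<1+b eq → detects l d l-prime (ℕ.≤∧≢⇒< (ℕ.s≤s⁻¹ l<1+b)
          (λ { ≡.refl → ¬b (l-prime , divides d eq) })) eq }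
      where open Detector D
    ... | D | yes (prime-b , divides d N≡db) = record
      { u = u * factor d ; r = b ℕ.* r
      ; r-coprime = λ l l-prime b<l l∣br → case euclidsLemma b r l-prime l∣br of λ
          { (inj₁ l∣b) → ℕ.<⇒≱ b<l (∣⇒≤ {{prime⇒nonZero prime-b}} l∣b)
          ; (inj₂ l∣r) → r-coprime l l-prime (ℕ.<⇒≤ b<l) l∣r }
      ; u-at-0 = at-0
      ; support = support′
      ; detects = detects′ }
      where
      open Detector D
      coeff : ∀ j → (u * factor d) j ≡ u j F.+ F.- u (j ⊖ G.[ d ])
      coeff = ⋆-1-X^ 𝔽.ℤ/ m u d

      vanish : ∀ {x y} → x ≡ F.0# → y ≡ F.0# → x F.+ F.- y ≡ F.0#
      vanish ≡.refl ≡.refl = F.-‿inverseʳ F.0#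

      shift : ∀ j → G.[ r ] G.⊗ (j ⊖ G.[ d ]) ≡ G.[ 0 ] → G.[ r ] G.⊗ j ≡ G.[ r ℕ.* d ]
      shift j eq = ≡.trans (≡.cong (G.[ r ] G.⊗_) (≡.sym (G.⊖-⊕ j G.[ d ])))
        (≡.trans (G.⊗-distribˡ-⊕ G.[ r ] (j ⊖ G.[ d ]) G.[ d ])
        (≡.trans (≡.cong (_⊕ (G.[ r ] G.⊗ G.[ d ])) eq)
        (≡.trans (G.⊕-identityˡ (G.[ r ] G.⊗ G.[ d ])) (G.[]-* r d))))

      b-times : ∀ x j → G.[ r ] G.⊗ j ≡ G.[ x ] → G.[ b ℕ.* r ] G.⊗ j ≡ G.[ b ℕ.* x ]
      b-times x j eq = ≡.trans (≡.cong (G._⊗ j) (≡.sym (G.[]-* b r)))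
        (≡.trans (G.⊗-assoc G.[ b ] G.[ r ] j) (≡.trans (≡.cong (G.[ b ] G.⊗_) eq) (G.[]-* b x)))

      -- Since N = d b, this is a multiple of N, which puts the support shifted by d into the kernel
      -- of multiplication by b r.
      b*rd : b ℕ.* (r ℕ.* d) ≡ r ℕ.* N
      b*rd = ≡.trans (swap b r d) (≡.cong (r ℕ.*_) (≡.sym N≡db))
        where
        open import Data.Nat.Solver
        open +-*-Solver
        swap : ∀ a b c → a ℕ.* (b ℕ.* c) ≡ b ℕ.* (c ℕ.* a)
        swap = solve 3 (λ a b c → a :* (b :* c) := b :* (c :* a)) ≡.refl

      support′ : ∀ j → (u * factor d) j ≡ F.0# ⊎ G.[ b ℕ.* r ] G.⊗ j ≡ G.[ 0 ]
      support′ j with support j | support (j ⊖ G.[ d ])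
      ... | inj₁ p | inj₁ q = inj₁ (≡.trans (coeff j) (vanish p q))
      ... | inj₂ p | _      = inj₂ (≡.trans (b-times 0 j p) (≡.cong G.[_] (ℕ.*-zeroʳ b)))
      ... | _      | inj₂ q = inj₂ (≡.trans (b-times (r ℕ.* d) j (shift j q))
            (≡.trans (≡.cong G.[_] b*rd) (G.[]-cong-% (r ℕ.* N) 0 (m*n%n≡0 r N))))

      -- The constant coefficient changes by the coefficient of u at - d. If that index met the
      -- support condition, N = d b would divide r d, so b would divide r, contrary to `r-coprime`.
      -- Hence the change is zero.
      at-0 : (u * factor d) G.[ 0 ] ≡ F.1#
      at-0 with support (G.[ 0 ] ⊖ G.[ d ])
      ... | inj₁ q = ≡.trans (coeff G.[ 0 ]) (≡.trans (≡.cong₂ (λ x y → x F.+ F.- y) u-at-0 q)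
            (≡.trans (≡.cong (F.1# F.+_) neg-0) (F.+-identityʳ F.1#)))
        where
        neg-0 : F.- F.0# ≡ F.0#
        neg-0 = ≡.trans (≡.sym (F.+-identityˡ _)) (F.-‿inverseʳ F.0#)
      ... | inj₂ q = contradiction b∣r (r-coprime b prime-b ℕ.≤-refl)
        where
        N∣rd : N ∣ r ℕ.* d
        N∣rd = m%n≡0⇒n∣m (r ℕ.* d) N (G.[]-injective-% (r ℕ.* d) 0
          (≡.trans (≡.sym (shift G.[ 0 ] q)) (≡.trans (G.[]-* r 0) (≡.cong G.[_] (ℕ.*-zeroʳ r)))))
        instance
          d≢0 : ℕ.NonZero d
          d≢0 = ℕ.≢-nonZero λ d≡0 → ℕ.1+n≢0 (≡.trans N≡db (≡.cong (ℕ._* b) d≡0))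
        b∣r : b ∣ r
        b∣r = *-cancelˡ-∣ d (≡.subst₂ _∣_ N≡db (ℕ.*-comm r d) N∣rd)

      detects′ : ∀ l e → Prime l → l < suc b → N ≡ e ℕ.* l → ∃[ w ] u * factor d ≈ factor e * w
      detects′ l e l-prime l<1+b eq with l ℕ.≟ b
      -- For l = b the equation N = e b = d b identifies e with d, and the old product u is the
      -- cofactor.
      ... | yes ≡.refl with ≡.refl ← ℕ.*-cancelʳ-≡ e d b {{prime⇒nonZero l-prime}} (≡.trans (≡.sym eq) N≡db) = u , *-comm u (factor d)
      ... | no  l≢b with w , u≈ ← detects l e l-prime (ℕ.≤∧≢⇒< (ℕ.s≤s⁻¹ l<1+b) l≢b) eq =
        w * factor d , trans (*-congʳ {factor d} {u} {factor e * w} u≈) (*-assoc (factor e) w (factor d))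

    splittingDomain : Σ[ K ∈ CommutativeRing 0ℓ 0ℓ ] IsSplittingDomain K p N (suc N)
    splittingDomain = splitting A p m _≟_ p×≈0 (all-fixed pr k p^k≡)
      -- The pᴺ coefficient functions list all elements of the algebra.
      {p ℕ.^ N} finToFun (λ x → funToFin x , λ j → ≡.sym (finToFun-funToFin x j))
      u (λ u≈0 → 1≢0 (≡.trans (≡.sym u-at-0) (u≈0 G.[ 0 ]))) (X 1) Xᴺ detects′
      where
      -- Every prime divisor of N is at most N, so the bound N + 1 covers all of them.
      open Detector (detector (suc N))

      X1^ : ∀ d → X 1 ^ d ≈ X d
      X1^ d = trans (X^-* 𝔽.ℤ/ m 1 d) (X^-cong 𝔽.ℤ/ m (1 ℕ.* d) d (≡.cong G.[_] (ℕ.*-identityˡ d)))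

      Xᴺ : X 1 ^ N ≈ 1#
      Xᴺ = trans (X1^ N) (X^-cong 𝔽.ℤ/ m N 0 (G.[]-cong-% N 0 (n%n≡0 N)))

      detects′ : ∀ l d → Prime l → N ≡ d ℕ.* l → ∃[ w ] u ≈ (1# + - X 1 ^ d) * w
      detects′ l d l-prime eq with w , u≈ ← detects l d l-prime (s≤s (∣⇒≤ (divides d eq))) eq =
        w , trans u≈ (*-congʳ {w} {factor d} (λ j → ≡.cong (λ y → 1# j F.+ F.- y) (≡.sym (X1^ d j))))

-- Roots of polynomials over a domain

module Roots where
  open import Algebra.Bundles using (CommutativeRing)
  open import Data.Fin.Base using (Fin; zero; suc)
  open import Data.Nat.Base using (zero; suc)
  open import Data.Product using (_×_; _,_; proj₂)
  open import Data.Sum.Base using (_⊎_; inj₁; inj₂)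
  open import Data.Vec.Base using (Vec; []; _∷_)
  open import Data.Vec.Relation.Unary.All using (All; []; _∷_)
  open import Function.Base using (_∘_)
  open import Level using (0ℓ)
  open import Relation.Binary.PropositionalEquality as ≡ using (_≡_)
  open import Relation.Nullary using (¬_; contradiction)

  module _ (K : CommutativeRing 0ℓ 0ℓ) where

    open CommutativeRing K hiding (zero)
    open import Algebra.Properties.Semiring.Exp semiring
    open import Algebra.Properties.Group +-group using (∙-cancelˡ; ∙-cancelʳ)
    open import Algebra.Solver.Ring.NaturalCoefficients.Default commutativeSemiring
    open import Relation.Binary.Reasoning.Setoid setoid

    eval : ∀ {n} → Vec Carrier n → Carrier → Carrier
    eval []       x = 0#
    eval (c ∷ cs) x = c + x * eval cs x

    -- Synthetic division: for f = c ∷ cs the quotient of f(X) - f(a) by X - a.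
    horner : ∀ {n} → Carrier → Vec Carrier n → Vec Carrier n
    horner a []       = []
    horner a (c ∷ cs) = eval (c ∷ cs) a ∷ horner a cs

    -- x f(x) - a f(a) = (x - a) q(x), with both sides moved so that no subtraction occurs.
    horner-eval : ∀ {n} a x (cs : Vec Carrier n) →
      x * eval cs x + a * eval (horner a cs) x ≈ a * eval cs a + x * eval (horner a cs) x
    horner-eval a x []       = solve 2 (λ a x → x :* con 0 :+ a :* con 0 := a :* con 0 :+ x :* con 0) refl a x
    horner-eval a x (c ∷ cs) = begin
      x * (c + x * p) + a * ((c + a * r) + x * h)
        ≈⟨ solve 6 (λ a x c p r h → x :* (c :+ x :* p) :+ a :* ((c :+ a :* r) :+ x :* h)
             := (x :* c :+ a :* (c :+ a :* r)) :+ x :* (x :* p :+ a :* h)) refl a x c p r h ⟩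
      (x * c + a * (c + a * r)) + x * (x * p + a * h)
        ≈⟨ +-congˡ (*-congˡ (horner-eval a x cs)) ⟩
      (x * c + a * (c + a * r)) + x * (a * r + x * h)
        ≈⟨ solve 5 (λ a x c r h → (x :* c :+ a :* (c :+ a :* r)) :+ x :* (a :* r :+ x :* h)
             := a :* (c :+ a :* r) :+ x :* ((c :+ a :* r) :+ x :* h)) refl a x c r h ⟩
      a * (c + a * r) + x * ((c + a * r) + x * h) ∎
      where
      p = eval cs x
      r = eval cs a
      h = eval (horner a cs) x

    -- The entries of the quotient are the values at a of the successive tails of the coefficient
    -- list. When the values of two consecutive tails vanish, so does the coefficient by which the
    -- tails differ; `go` carries the value along for this.
    horner-zero : ∀ {n} a (cs : Vec Carrier n) → All (_≈ 0#) (horner a cs) → All (_≈ 0#) cs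
    horner-zero a cs zs = proj₂ (go cs zs)
      where
      go : ∀ {n} (cs : Vec Carrier n) → All (_≈ 0#) (horner a cs) → eval cs a ≈ 0# × All (_≈ 0#) cs
      go []       []       = refl , []
      go (c ∷ cs) (z ∷ zs) with go cs zs
      ... | r≈0 , cs≈0 = z , (begin
        c                    ≈⟨ +-identityʳ c ⟨
        c + 0#               ≈⟨ +-congˡ (zeroʳ a) ⟨
        c + a * 0#           ≈⟨ +-congˡ (*-congˡ r≈0) ⟨
        c + a * eval cs a    ≈⟨ z ⟩
        0#                   ∎) ∷ cs≈0

    module _ (domain : ∀ x y → x * y ≈ 0# → x ≈ 0# ⊎ y ≈ 0#) where

      private
        difference : ∀ {x y z} → x * z ≈ y * z → x ≈ y ⊎ z ≈ 0#
        difference {x} {y} {z} eq with domain (x + - y) z (begin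
            (x + - y) * z        ≈⟨ distribʳ z x (- y) ⟩
            x * z + - y * z      ≈⟨ +-congʳ eq ⟩
            y * z + - y * z      ≈⟨ distribʳ z y (- y) ⟨
            (y + - y) * z        ≈⟨ *-congʳ (-‿inverseʳ y) ⟩
            0# * z               ≈⟨ zeroˡ z ⟩
            0#                   ∎)
        ... | inj₂ z≈0 = inj₂ z≈0
        ... | inj₁ x-y≈0 = inj₁ (∙-cancelʳ (- y) x y (trans x-y≈0 (sym (-‿inverseʳ y))))

      *-cancelʳ-≉0 : ∀ {x y z} → ¬ z ≈ 0# → x * z ≈ y * z → x ≈ y
      *-cancelʳ-≉0 z≉0 eq with difference eq
      ... | inj₁ x≈y = x≈y
      ... | inj₂ z≈0 = contradiction z≈0 z≉0

      -- (r - y) (a - b) = 0, written without subtraction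
      cross-cancel : ∀ r y a b → r * a + y * b ≈ y * a + r * b → r ≈ y ⊎ a ≈ b
      cross-cancel r y a b eq with difference {a} {b} {r + - y} (∙-cancelˡ (y * (a + b)) _ _ (begin
          y * (a + b) + a * (r + - y)
            ≈⟨ solve 5 (λ r y m a b → y :* (a :+ b) :+ a :* (r :+ m) := (r :* a :+ y :* b) :+ a :* (y :+ m)) refl r y (- y) a b ⟩
          (r * a + y * b) + a * (y + - y)
            ≈⟨ +-cong eq (*-congˡ (-‿inverseʳ y)) ⟩
          (y * a + r * b) + a * 0#
            ≈⟨ +-congˡ (trans (zeroʳ a) (sym (zeroʳ b))) ⟩
          (y * a + r * b) + b * 0#
            ≈⟨ +-congˡ (*-congˡ (-‿inverseʳ y)) ⟨
          (y * a + r * b) + b * (y + - y)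
            ≈⟨ solve 5 (λ r y m a b → (y :* a :+ r :* b) :+ b :* (y :+ m) := y :* (a :+ b) :+ b :* (r :+ m)) refl r y (- y) a b ⟩
          y * (a + b) + b * (r + - y) ∎))
      ... | inj₁ a≈b = inj₂ a≈b
      ... | inj₂ r-y≈0 = inj₁ (∙-cancelʳ (- y) r y (trans r-y≈0 (sym (-‿inverseʳ y))))

      -- Induction on the number of coefficients: dividing by X - a for the first root a leaves a
      -- quotient that vanishes at the remaining roots, since these differ from a.
      roots : ∀ {n} (cs : Vec Carrier n) (f : Fin n → Carrier) → (∀ i j → f i ≈ f j → i ≡ j) →
        (∀ i → eval cs (f i) ≈ 0#) → All (_≈ 0#) cs
      roots []       f inj root = []
      roots {suc n} (c ∷ cs) f inj root = c≈0 ∷ cs≈0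
        where
        a = f zero
        quotient-root : ∀ i → eval (horner a cs) (f (suc i)) ≈ 0#
        quotient-root i with difference {f (suc i)} {a} {eval (horner a cs) (f (suc i))} (begin
            x * h                               ≈⟨ +-identityˡ _ ⟨
            0# + x * h                          ≈⟨ +-congʳ (root zero) ⟨
            (c + a * eval cs a) + x * h         ≈⟨ +-assoc _ _ _ ⟩
            c + (a * eval cs a + x * h)         ≈⟨ +-congˡ (horner-eval a x cs) ⟨
            c + (x * eval cs x + a * h)         ≈⟨ +-assoc _ _ _ ⟨
            (c + x * eval cs x) + a * h         ≈⟨ +-congʳ (root (suc i)) ⟩
            0# + a * h                          ≈⟨ +-identityˡ _ ⟩
            a * h                               ∎)
          where
          x = f (suc i)
          h = eval (horner a cs) x
        ... | inj₂ h≈0 = h≈0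
        ... | inj₁ x≈a with () ← inj (suc i) zero x≈a
        cs≈0 : All (_≈ 0#) cs
        -- The quotient is zero by induction, which kills all coefficients but the constant one;
        -- evaluation at the root a then kills that one too.
        cs≈0 = horner-zero a cs (roots (horner a cs) (f ∘ suc) (λ i j eq → suc-inj (inj _ _ eq)) quotient-root)
          where
          suc-inj : ∀ {i j : Fin n} → Fin.suc i ≡ suc j → i ≡ j
          suc-inj ≡.refl = ≡.refl
        eval-zero : ∀ {n} {ds : Vec Carrier n} → All (_≈ 0#) ds → ∀ x → eval ds x ≈ 0#
        eval-zero []       x = refl
        eval-zero (z ∷ zs) x = trans (+-cong z (trans (*-congˡ (eval-zero zs x)) (zeroʳ x))) (+-identityˡ 0#)
        c≈0 : c ≈ 0#
        c≈0 = begin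
          c                       ≈⟨ +-identityʳ c ⟨
          c + 0#                  ≈⟨ +-congˡ (trans (*-congˡ (eval-zero cs≈0 a)) (zeroʳ a)) ⟨
          c + a * eval cs a       ≈⟨ root zero ⟩
          0#                      ∎

      monomial : ∀ n → Vec Carrier (suc n)
      monomial zero    = 1# ∷ []
      monomial (suc n) = 0# ∷ monomial n

      eval-monomial : ∀ n x → eval (monomial n) x ≈ x ^ n
      eval-monomial zero    x = trans (+-congˡ (zeroʳ x)) (+-identityʳ 1#)
      eval-monomial (suc n) x = trans (+-identityˡ _) (*-congˡ (eval-monomial n x))

      monomial≉0 : ∀ n → ¬ 1# ≈ 0# → ¬ All (_≈ 0#) (monomial n)
      monomial≉0 zero    1≉0 (z ∷ _)  = 1≉0 z
      monomial≉0 (suc n) 1≉0 (_ ∷ zs) = monomial≉0 n 1≉0 zs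

      -- The polynomial Xᵐ⁺¹ - 1 has m + 2 coefficients, not all zero, so it cannot have m + 2
      -- distinct roots.
      roots-of-unity : ¬ 1# ≈ 0# → ∀ m (f : Fin (suc (suc m)) → Carrier) → (∀ i j → f i ≈ f j → i ≡ j) →
        ¬ (∀ i → f i ^ suc m ≈ 1#)
      roots-of-unity 1≉0 m f inj unity with roots (- 1# ∷ monomial m) f inj
          (λ i → trans (+-congˡ (trans (*-congˡ (eval-monomial m (f i))) (unity i))) (-‿inverseˡ 1#))
      ... | _ ∷ zs = monomial≉0 m 1≉0 zs

      quadratic : Carrier → Carrier → Carrier → Carrier → Carrier
      quadratic a b c x = a + x * (b + x * c)

      private
        combine : ∀ x u v p r → (u + x * p) + (v + x * r) ≈ (u + v) + x * (p + r)
        combine x u v p r = begin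
          (u + x * p) + (v + x * r)     ≈⟨ +-medial u (x * p) v (x * r) ⟩
          (u + v) + (x * p + x * r)     ≈⟨ +-congˡ (distribˡ x p r) ⟨
          (u + v) + x * (p + r)         ∎
          where open import Algebra.Properties.CommutativeSemigroup +-commutativeSemigroup
                  renaming (interchange to +-medial)

        restore : ∀ y z → (y + - z) + z ≈ y
        restore y z = trans (+-assoc y (- z) z) (trans (+-congˡ (-‿inverseˡ z)) (+-identityʳ y))

        equal : ∀ {x y} → x + - y ≈ 0# → x ≈ y
        equal {x} {y} eq = ∙-cancelʳ (- y) x y (trans eq (sym (-‿inverseʳ y)))

      module _ {a b c a′ b′ c′ : Carrier} where

        private
          difference-coefficients : Vec Carrier 3
          difference-coefficients = (a + - a′) ∷ (b + - b′) ∷ (c + - c′) ∷ []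

          difference-root : ∀ x → quadratic a b c x ≈ quadratic a′ b′ c′ x → eval difference-coefficients x ≈ 0#
          difference-root x eq = ∙-cancelʳ (quadratic a′ b′ c′ x) (eval difference-coefficients x) 0# (begin
            eval difference-coefficients x + quadratic a′ b′ c′ x
              ≈⟨ combine x (a + - a′) a′ _ _ ⟩
            ((a + - a′) + a′) + x * (((b + - b′) + x * ((c + - c′) + x * 0#)) + (b′ + x * c′))
              ≈⟨ +-cong (restore a a′) (*-congˡ (combine x (b + - b′) b′ _ _)) ⟩
            a + x * (((b + - b′) + b′) + x * (((c + - c′) + x * 0#) + c′))
              ≈⟨ +-congˡ (*-congˡ (+-cong (restore b b′) (*-congˡ (+-congʳ (trans (+-congˡ (zeroʳ x)) (+-identityʳ (c + - c′))))))) ⟩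
            a + x * (b + x * ((c + - c′) + c′))
              ≈⟨ +-congˡ (*-congˡ (+-congˡ (*-congˡ (restore c c′)))) ⟩
            quadratic a b c x
              ≈⟨ eq ⟩
            quadratic a′ b′ c′ x
              ≈⟨ +-identityˡ (quadratic a′ b′ c′ x) ⟨
            0# + quadratic a′ b′ c′ x ∎)

        -- The difference of the two quadratics has three coefficients, and three distinct roots
        -- force all of them to vanish.
        quadratic-unique : ∀ (f : Fin 3 → Carrier) → (∀ i j → f i ≈ f j → i ≡ j) →
          (∀ i → quadratic a b c (f i) ≈ quadratic a′ b′ c′ (f i)) → a ≈ a′ × b ≈ b′ × c ≈ c′
        quadratic-unique f inj agree = coefficients (roots difference-coefficients f inj (λ i → difference-root (f i) (agree i)))
          where
          coefficients : All (_≈ 0#) difference-coefficients → a ≈ a′ × b ≈ b′ × c ≈ c′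
          coefficients (z₀ ∷ z₁ ∷ z₂ ∷ []) = equal z₀ , equal z₁ , equal z₂

-- Singer's construction by discrete logarithms

module Singer where
  open import Defs using (_⊕_)
  open Residues
  open Semisimple
  open Roots
  open import Algebra.Bundles using (CommutativeRing)
  open import Data.Fin.Base using (Fin; zero; suc; toℕ)
  open import Data.Fin.Patterns using (0F; 1F; 2F)
  open import Data.Fin.Properties using (toℕ<n; toℕ-injective; any?)
  open import Data.Nat.Base as ℕ using (ℕ; zero; suc; _<_; _≤_; _∸_)
  import Data.Nat.Properties as ℕ
  open import Data.Nat.Divisibility using (_∣_; ∣⇒≤)
  open import Data.Product using (∃-syntax; ∃₂; _,_; proj₁; proj₂)
  open import Data.Sum.Base as Sum using (_⊎_; inj₁; inj₂)
  open import Level using (0ℓ)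
  open import Relation.Binary.PropositionalEquality as ≡ using (_≡_)
  open import Relation.Nullary using (¬_; yes; no; contradiction)

  module _ (K : CommutativeRing 0ℓ 0ℓ) (q₁ n₁ m : ℕ) where

    private
      q = suc q₁
      n = suc n₁
      N = suc m

    open CommutativeRing K hiding (zero)
    open import Algebra.Properties.Semiring.Exp semiring
    open import Algebra.Properties.CommutativeSemiring.Exp commutativeSemiring using (^-distrib-*)
    open import Algebra.Properties.Group +-group using (∙-cancelˡ)
    open import Algebra.Properties.CommutativeSemigroup *-commutativeSemigroup using (interchange; x∙yz≈y∙xz)
    open import Relation.Binary.Reasoning.Setoid setoid

    module _ {p} (D : IsSplittingDomain K p N (suc N))
      (frobenius : ∀ x y → (x + y) ^ q ≈ x ^ q + y ^ q) 
      (1<q : 1 < q) (N≡ : N ≡ q₁ ℕ.* n) (1+N≡q³ : suc N ≡ q ℕ.* (q ℕ.* q)) where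

      open IsSplittingDomain D

      private
        cancel : ∀ {x y z} → ¬ z ≈ 0# → x * z ≈ y * z → x ≈ y
        cancel = *-cancelʳ-≉0 K domain

      1^ : ∀ k → 1# ^ k ≈ 1#
      1^ = Order.1^ K

      θ^≉0 : ∀ a → ¬ θ ^ a ≈ 0#
      θ^≉0 zero    = 1≉0
      θ^≉0 (suc a) eq with domain θ (θ ^ a) eq
      ... | inj₁ θ≈0  = 1≉0 (trans (sym θᴺ≈1) (trans (*-congʳ θ≈0) (zeroˡ _)))
      ... | inj₂ θᵃ≈0 = θ^≉0 a θᵃ≈0

      θ^-∣ : ∀ {a b} → a ≤ b → θ ^ a ≈ θ ^ b → N ∣ b ∸ a
      θ^-∣ {a} {b} a≤b eq = θ-order (b ∸ a) (cancel (θ^≉0 a) (begin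
        θ ^ (b ∸ a) * θ ^ a        ≈⟨ ^-homo-* θ (b ∸ a) a ⟨
        θ ^ (b ∸ a ℕ.+ a)          ≈⟨ ^-congʳ θ (ℕ.m∸n+n≡m a≤b) ⟩
        θ ^ b                      ≈⟨ eq ⟨
        θ ^ a                      ≈⟨ *-identityˡ _ ⟨
        1# * θ ^ a                 ∎))

      private
        ≤-case : ∀ {a b} → b < N → a ≤ b → N ∣ b ∸ a → a ≡ b
        ≤-case {a} {b} b<N a≤b N∣ with b ∸ a in b∸a≡
        ... | zero  = ℕ.≤-antisym a≤b (ℕ.m∸n≡0⇒m≤n b∸a≡)
        ... | suc d = contradiction (ℕ.≤-trans (∣⇒≤ N∣) (≡.subst (_≤ b) b∸a≡ (ℕ.m∸n≤m b a))) (ℕ.<⇒≱ b<N)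

      θ^-injective : ∀ {a b} → a < N → b < N → θ ^ a ≈ θ ^ b → a ≡ b
      θ^-injective {a} {b} a<N b<N eq with ℕ.≤-total a b
      ... | inj₁ a≤b = ≤-case b<N a≤b (θ^-∣ a≤b eq)
      ... | inj₂ b≤a = ≡.sym (≤-case a<N b≤a (θ^-∣ b≤a (sym eq)))

      θ^-unity : ∀ a → (θ ^ a) ^ N ≈ 1#
      θ^-unity a = begin
        (θ ^ a) ^ N          ≈⟨ ^-assocʳ θ a N ⟩
        θ ^ (a ℕ.* N)        ≈⟨ ^-congʳ θ (ℕ.*-comm a N) ⟩
        θ ^ (N ℕ.* a)        ≈⟨ ^-assocʳ θ N a ⟨
        (θ ^ N) ^ a          ≈⟨ ^-congˡ a θᴺ≈1 ⟩
        1# ^ a               ≈⟨ 1^ a ⟩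
        1#                   ∎

      -- Every nonzero x satisfies xᴺ = 1. If x were missing from the N distinct powers of θ, then
      -- Xᴺ - 1 would have N + 1 roots.
      logarithm : ∀ x → ¬ x ≈ 0# → ∃[ a ] x ≈ θ ^ a
      logarithm x x≉0 with any? {N} (λ i → x ≟ (θ ^ toℕ i))
      ... | yes (i , eq) = toℕ i , eq
      ... | no  ¬power   = contradiction unity (roots-of-unity K domain 1≉0 m f f-injective)
        where
        f : Fin (suc N) → Carrier
        f zero    = x
        f (suc i) = θ ^ toℕ i
        f-injective : ∀ i j → f i ≈ f j → i ≡ j
        f-injective zero    zero    eq = ≡.refl
        f-injective zero    (suc j) eq = contradiction (j , eq) ¬power
        f-injective (suc i) zero    eq = contradiction (i , sym eq) ¬power
        f-injective (suc i) (suc j) eq = ≡.cong suc (toℕ-injective (θ^-injective (toℕ<n i) (toℕ<n j) eq))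
        unity : ∀ i → f i ^ N ≈ 1#
        unity zero    = cancel x≉0 (trans (*-comm _ x) (trans (power x) (sym (*-identityˡ x))))
        unity (suc i) = θ^-unity (toℕ i)

      F : Carrier → Carrier
      F x = x ^ q

      F-* : ∀ x y → F (x * y) ≈ F x * F y
      F-* x y = ^-distrib-* x y q

      -- The exponent n a q exceeds n a by n a (q - 1) = a N, and θᴺ = 1.
      F-θ^n : ∀ a → F (θ ^ (n ℕ.* a)) ≈ θ ^ (n ℕ.* a)
      F-θ^n a = begin
        (θ ^ (n ℕ.* a)) ^ q                        ≈⟨ ^-assocʳ θ (n ℕ.* a) q ⟩
        θ ^ (n ℕ.* a ℕ.* q)                        ≈⟨ ^-congʳ θ (≡.trans (split n a q₁) (≡.cong (λ k → n ℕ.* a ℕ.+ a ℕ.* k) (≡.sym N≡))) ⟩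
        θ ^ (n ℕ.* a ℕ.+ a ℕ.* N)                  ≈⟨ ^-homo-* θ (n ℕ.* a) (a ℕ.* N) ⟩
        θ ^ (n ℕ.* a) * θ ^ (a ℕ.* N)              ≈⟨ *-congˡ (trans (sym (^-assocʳ θ a N)) (θ^-unity a)) ⟩
        θ ^ (n ℕ.* a) * 1#                         ≈⟨ *-identityʳ _ ⟩
        θ ^ (n ℕ.* a)                              ∎
        where
        split : ∀ n a k → n ℕ.* a ℕ.* suc k ≡ n ℕ.* a ℕ.+ a ℕ.* (k ℕ.* n)
        split n a k = ≡.trans (ℕ.*-suc (n ℕ.* a) k) (≡.cong (n ℕ.* a ℕ.+_)
          (≡.trans (≡.cong (ℕ._* k) (ℕ.*-comm n a)) (≡.trans (ℕ.*-assoc a n k) (≡.cong (a ℕ.*_) (ℕ.*-comm n k)))))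

      -- The subfield with q elements: zero and the powers of θⁿ, whose order is N/n = q - 1.
      φ : Fin q → Carrier
      φ zero    = 0#
      φ (suc i) = θ ^ (n ℕ.* toℕ i)

      φ-injective : ∀ i j → φ i ≈ φ j → i ≡ j
      φ-injective zero    zero    eq = ≡.refl
      φ-injective zero    (suc j) eq = contradiction (sym eq) (θ^≉0 (n ℕ.* toℕ j))
      φ-injective (suc i) zero    eq = contradiction eq (θ^≉0 (n ℕ.* toℕ i))
      φ-injective (suc i) (suc j) eq = ≡.cong suc (toℕ-injective (ℕ.*-cancelˡ-≡ (toℕ i) (toℕ j) n
        (θ^-injective (bound i) (bound j) eq)))
        where
        bound : ∀ (i : Fin q₁) → n ℕ.* toℕ i < N
        bound i = ≡.subst (n ℕ.* toℕ i <_) (≡.trans (ℕ.*-comm n q₁) (≡.sym N≡)) (ℕ.*-monoʳ-< n (toℕ<n i))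

      F-φ : ∀ i → F (φ i) ≈ φ i
      F-φ zero    = zeroˡ _
      F-φ (suc i) = F-θ^n (toℕ i)

      conjugate : Fin 3 → Carrier
      conjugate 0F = θ
      conjugate 1F = F θ
      conjugate 2F = F (F θ)

      private
        exponent : Fin 3 → ℕ
        exponent 0F = 1
        exponent 1F = q
        exponent 2F = q ℕ.* q

        conjugate≈ : ∀ i → conjugate i ≈ θ ^ exponent i
        conjugate≈ 0F = sym (*-identityʳ θ)
        conjugate≈ 1F = refl
        conjugate≈ 2F = ^-assocʳ θ q q

        q<q² : q < q ℕ.* q
        q<q² = ℕ.m<m*n q q 1<q
        q²<N : q ℕ.* q < N
        -- The chain is q² + 1 < 2 q² ≤ q³ = N + 1.
        q²<N = ℕ.s≤s⁻¹ (≡.subst (suc (q ℕ.* q) <_) (≡.sym 1+N≡q³)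
          (ℕ.<-≤-trans (≡.subst (_< q ℕ.* q ℕ.+ q ℕ.* q) (ℕ.+-comm (q ℕ.* q) 1) (ℕ.+-monoʳ-< (q ℕ.* q) (ℕ.<-trans 1<q q<q²)))
            (ℕ.≤-trans (ℕ.≤-reflexive (≡.cong (q ℕ.* q ℕ.+_) (≡.sym (ℕ.+-identityʳ _)))) (ℕ.*-monoˡ-≤ (q ℕ.* q) 1<q))))
        exponent<N : ∀ i → exponent i < N
        exponent<N 0F = ℕ.<-trans 1<q (ℕ.<-trans q<q² q²<N)
        exponent<N 1F = ℕ.<-trans q<q² q²<N
        exponent<N 2F = q²<N
        exponent-injective : ∀ i j → exponent i ≡ exponent j → i ≡ j
        exponent-injective 0F 0F _  = ≡.refl
        exponent-injective 1F 1F _  = ≡.refl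
        exponent-injective 2F 2F _  = ≡.refl
        exponent-injective 0F 1F eq = contradiction eq (ℕ.<⇒≢ 1<q)
        exponent-injective 1F 0F eq = contradiction (≡.sym eq) (ℕ.<⇒≢ 1<q)
        exponent-injective 0F 2F eq = contradiction eq (ℕ.<⇒≢ (ℕ.<-trans 1<q q<q²))
        exponent-injective 1F 2F eq = contradiction eq (ℕ.<⇒≢ q<q²)
        exponent-injective 2F 0F eq = contradiction (≡.sym eq) (ℕ.<⇒≢ (ℕ.<-trans 1<q q<q²))
        exponent-injective 2F 1F eq = contradiction (≡.sym eq) (ℕ.<⇒≢ q<q²)

      -- The exponents 1, q and q² of θ are distinct and below its order N.
      conjugate-injective : ∀ i j → conjugate i ≈ conjugate j → i ≡ j
      conjugate-injective i j eq = exponent-injective i j (θ^-injective (exponent<N i) (exponent<N j)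
        (trans (sym (conjugate≈ i)) (trans eq (conjugate≈ j))))

      -- The points of the projective line over 𝔽_q, embedded in the field as r + s θ.
      r s : Fin (suc q) → Carrier
      r zero    = 1#
      r (suc i) = φ i
      s zero    = 0#
      s (suc i) = 1#

      F-r : ∀ i → F (r i) ≈ r i
      F-r zero    = 1^ q
      F-r (suc i) = F-φ i

      F-s : ∀ i → F (s i) ≈ s i
      F-s zero    = zeroˡ _
      F-s (suc i) = 1^ q

      point : Fin (suc q) → Carrier → Carrier
      point i x = r i + s i * x

      F-point : ∀ i x → F (point i x) ≈ point i (F x)
      F-point i x = trans (frobenius (r i) (s i * x)) (+-cong (F-r i) (trans (F-* (s i) x) (*-congʳ (F-s i))))

      -- The coordinate pairs are normalised to (1, 0) and (φ, 1), so distinct ones are not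
      -- proportional.
      proportional : ∀ i k → r i * s k ≈ s i * r k → i ≡ k
      proportional zero    zero    eq = ≡.refl
      proportional zero    (suc k) eq = contradiction (trans (sym (*-identityˡ 1#)) (trans eq (zeroˡ _))) 1≉0
      proportional (suc i) zero    eq = contradiction (trans (sym (*-identityˡ 1#)) (trans (sym eq) (zeroʳ _))) 1≉0
      proportional (suc i) (suc k) eq = ≡.cong suc (φ-injective i k
        (trans (sym (*-identityʳ _)) (trans eq (*-identityˡ _))))

      -- If φ + θ = 0, then applying F, which fixes φ, gives φ + F θ = 0 and hence F θ = θ, contrary
      -- to the distinctness of the conjugates.
      point-θ≉0 : ∀ i → ¬ point i θ ≈ 0#
      point-θ≉0 zero eq = 1≉0 (trans (sym (trans (+-congˡ (zeroˡ θ)) (+-identityʳ 1#))) eq)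
      point-θ≉0 (suc i) eq with () ← conjugate-injective 0F 1F (begin
        θ                  ≈⟨ *-identityˡ θ ⟨
        1# * θ             ≈⟨ ∙-cancelˡ (φ i) (1# * θ) (1# * F θ) (trans eq (sym (begin
          point (suc i) (F θ)     ≈⟨ F-point (suc i) θ ⟨
          F (point (suc i) θ)     ≈⟨ ^-congˡ q eq ⟩
          F 0#                    ≈⟨ zeroˡ _ ⟩
          0#                      ∎))) ⟩
        1# * F θ           ≈⟨ *-identityˡ (F θ) ⟩
        F θ                ∎)

      a : Fin (suc q) → ℕ
      a i = proj₁ (logarithm (point i θ) (point-θ≉0 i))

      θ^a : ∀ i → point i θ ≈ θ ^ a i
      θ^a i = proj₂ (logarithm (point i θ) (point-θ≉0 i))

      open Modulo n₁ using ([_]; []-+; []-≡⇒)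

      -- The nonzero constants of the subfield are the powers of θⁿ, so reducing logarithms modulo n
      -- disregards constant factors.
      L : Fin (suc q) → Fin n
      L i = [ a i ]

      -- The two products agree at θ, hence at its three conjugates, hence identically in x; so i, l
      -- and k, j describe the same roots in the projective line.
      sidon-products : ∀ i l k j t t′ → let c = θ ^ (n ℕ.* t); d = θ ^ (n ℕ.* t′) in
        (point i θ * point l θ) * c ≈ (point k θ * point j θ) * d → i ≡ k ⊎ i ≡ j
      sidon-products i l k j t t′ at-θ = Sum.map (proportional i k) (proportional i j)
        (cross-cancel K domain (r i * s k) (s i * r k) (r i * s j) (s i * r j) (cancel (θ^≉0 (n ℕ.* t′)) identity))
        where
        c = θ ^ (n ℕ.* t)
        d = θ ^ (n ℕ.* t′)

        Agree : Carrier → Set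
        Agree x = (point i x * point l x) * c ≈ (point k x * point j x) * d

        F-side : ∀ i l t x → F ((point i x * point l x) * θ ^ (n ℕ.* t)) ≈ (point i (F x) * point l (F x)) * θ ^ (n ℕ.* t)
        F-side i l t x = trans (F-* _ _) (*-cong (trans (F-* _ _) (*-cong (F-point i x) (F-point l x))) (F-θ^n t))

        -- F fixes the coefficients of the points and the constants c and d, so it carries agreement
        -- at x to agreement at F x.
        step : ∀ x → Agree x → Agree (F x)
        step x eq = trans (sym (F-side i l t x)) (trans (^-congˡ q eq) (F-side k j t′ x))

        agree : ∀ y → Agree (conjugate y)
        agree 0F = at-θ
        agree 1F = step θ at-θ
        agree 2F = step (F θ) (step θ at-θ)

        expand : ∀ i l c x → (point i x * point l x) * c ≈
          quadratic K domain ((r i * r l) * c) ((r i * s l + s i * r l) * c) ((s i * s l) * c) x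
        expand i l c x = begin
          ((ri + si * x) * (rl + sl * x)) * c
            ≈⟨ *-congʳ (trans (distribʳ (rl + sl * x) ri (si * x)) (+-cong (distribˡ ri rl (sl * x))
                 (trans (*-assoc si x _) (x∙yz≈y∙xz si x _)))) ⟩
          ((ri * rl + ri * (sl * x)) + x * (si * (rl + sl * x))) * c
            ≈⟨ *-congʳ (trans (+-assoc (ri * rl) _ _) (+-congˡ (+-cong (trans (sym (*-assoc ri sl x)) (*-comm _ x))
                 (*-congˡ (trans (distribˡ si rl (sl * x)) (+-congˡ (trans (sym (*-assoc si sl x)) (*-comm _ x)))))))) ⟩
          (ri * rl + (x * (ri * sl) + x * (si * rl + x * (si * sl)))) * c
            ≈⟨ *-congʳ (+-congˡ (trans (sym (distribˡ x _ _)) (*-congˡ (sym (+-assoc _ _ _))))) ⟩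
          (ri * rl + x * ((ri * sl + si * rl) + x * (si * sl))) * c
            ≈⟨ trans (distribʳ c _ _) (+-congˡ (trans (*-assoc x _ c) (*-congˡ (trans (distribʳ c _ _) (+-congˡ (*-assoc x _ c)))))) ⟩
          (ri * rl) * c + x * ((ri * sl + si * rl) * c + x * ((si * sl) * c)) ∎
          where
          ri = r i
          si = s i
          rl = r l
          sl = s l

        coefficients = quadratic-unique K domain conjugate conjugate-injective
          (λ y → trans (sym (expand i l c (conjugate y))) (trans (agree y) (expand k j d (conjugate y))))
        c₀ = proj₁ coefficients
        c₁ = proj₁ (proj₂ coefficients)
        c₂ = proj₂ (proj₂ coefficients)

        -- The two quadratics, made homogeneous, are evaluated at the zero (- r i, s i) of
        -- `point i`, where the product on the left vanishes. This gives (r i s k - s i r k) (r i s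
        -- j - s i r j) d = 0, here with the negative terms moved to the other side.
        identity : ((r i * s k) * (r i * s j) + (s i * r k) * (s i * r j)) * d ≈
                   ((s i * r k) * (r i * s j) + (r i * s k) * (s i * r j)) * d
        identity = begin
          ((ri * sk) * (ri * sj) + (si * rk) * (si * rj)) * d
            ≈⟨ factor₂ ri sk ri sj si rk si rj d ⟩
          (ri * ri) * ((sk * sj) * d) + (si * si) * ((rk * rj) * d)
            ≈⟨ +-cong (*-congˡ c₂) (*-congˡ c₀) ⟨
          (ri * ri) * ((si * sl) * c) + (si * si) * ((ri * rl) * c)
            ≈⟨ factor₂ ri si ri sl si ri si rl c ⟨
          ((ri * si) * (ri * sl) + (si * ri) * (si * rl)) * c
            ≈⟨ *-congʳ (+-congˡ (*-congʳ (*-comm si ri))) ⟩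
          ((ri * si) * (ri * sl) + (ri * si) * (si * rl)) * c
            ≈⟨ factor-common (ri * si) (ri * sl) (si * rl) c ⟨
          (ri * si) * ((ri * sl + si * rl) * c)
            ≈⟨ *-congˡ c₁ ⟩
          (ri * si) * ((rk * sj + sk * rj) * d)
            ≈⟨ factor-common (ri * si) (rk * sj) (sk * rj) d ⟩
          ((ri * si) * (rk * sj) + (ri * si) * (sk * rj)) * d
            ≈⟨ *-congʳ (+-cong (trans (*-congʳ (*-comm ri si)) (interchange si ri rk sj)) (interchange ri si sk rj)) ⟩
          ((si * rk) * (ri * sj) + (ri * sk) * (si * rj)) * d ∎
          where
          ri = r i
          si = s i
          rl = r l
          sl = s l
          rk = r k
          sk = s k
          rj = r j
          sj = s j
          factor₂ : ∀ x y z w x′ y′ z′ w′ e → ((x * y) * (z * w) + (x′ * y′) * (z′ * w′)) * e ≈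
                    (x * z) * ((y * w) * e) + (x′ * z′) * ((y′ * w′) * e)
          factor₂ x y z w x′ y′ z′ w′ e = trans (distribʳ e _ _) (+-cong
            (trans (*-congʳ (interchange x y z w)) (*-assoc _ _ e))
            (trans (*-congʳ (interchange x′ y′ z′ w′)) (*-assoc _ _ e)))
          factor-common : ∀ x y z e → x * ((y + z) * e) ≈ (x * y + x * z) * e
          factor-common x y z e = trans (sym (*-assoc x (y + z) e)) (*-congʳ (distribˡ x y z))

      -- A congruence between sums of logarithms becomes an equality of exponents after multiples of
      -- n are added; these multiply the two products by powers of θⁿ.
      sidon : ∀ i l k j → L i ⊕ L l ≡ L k ⊕ L j → i ≡ k ⊎ i ≡ j
      sidon i l k j eq = compare ([]-≡⇒ (a i ℕ.+ a l) (a k ℕ.+ a j)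
          (≡.trans (≡.sym ([]-+ (a i) (a l))) (≡.trans eq ([]-+ (a k) (a j)))))
        where
        product : ∀ i l t → (point i θ * point l θ) * θ ^ (n ℕ.* t) ≈ θ ^ (a i ℕ.+ a l ℕ.+ n ℕ.* t)
        product i l t = begin
          (point i θ * point l θ) * θ ^ (n ℕ.* t)      ≈⟨ *-congʳ (*-cong (θ^a i) (θ^a l)) ⟩
          (θ ^ a i * θ ^ a l) * θ ^ (n ℕ.* t)          ≈⟨ *-congʳ (^-homo-* θ (a i) (a l)) ⟨
          θ ^ (a i ℕ.+ a l) * θ ^ (n ℕ.* t)            ≈⟨ ^-homo-* θ (a i ℕ.+ a l) (n ℕ.* t) ⟨
          θ ^ (a i ℕ.+ a l ℕ.+ n ℕ.* t)                ∎

        compare : (∃₂ λ t t′ → a i ℕ.+ a l ℕ.+ n ℕ.* t ≡ a k ℕ.+ a j ℕ.+ n ℕ.* t′) → i ≡ k ⊎ i ≡ j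
        compare (t , t′ , exponents) = sidon-products i l k j t t′ (trans (product i l t)
          (trans (^-congʳ θ exponents) (sym (product k j t′))))

-- From the Sidon property to a perfect difference set

module DifferenceSets where
  open import Defs using (_⊕_; _⊖_; IsPerfectDifferenceSet)
  open Residues
  open import Data.Bool.Base using (true; false)
  open import Data.Fin.Base using (Fin; zero; suc; toℕ; punchIn; remQuot; combine)
  open import Data.Fin.Properties
    using (_≟_; any?; suc-injective; punchInᵢ≢i; punchIn-injective; combine-remQuot; <⇒notInjective)
  open import Data.Fin.Subset using (Subset; _∈_; _∉_; ⊥; ⁅_⁆; _∪_; ∣_∣)
  open import Data.Fin.Subset.Properties
    using (∣⊥∣≡0; ∉⊥; x∈p∪q⁻; x∈p∪q⁺; x∈⁅x⁆; x∈⁅y⁆⇒x≡y; ∪-identityˡ)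
  open import Data.Vec.Base using (_∷_; here; there)
  open import Data.Nat.Base as ℕ using (ℕ; zero; suc)
  import Data.Nat.Properties as ℕ
  open import Data.Product using (∃-syntax; _×_; _,_; proj₁; proj₂)
  open import Data.Sum.Base using (_⊎_; inj₁; inj₂)
  open import Function.Base using (_∘_)
  open import Relation.Binary.PropositionalEquality
  open import Relation.Nullary using (yes; no; contradiction)

  ∣⁅x⁆∪p∣ : ∀ {n} (x : Fin n) p → x ∉ p → ∣ ⁅ x ⁆ ∪ p ∣ ≡ suc ∣ p ∣
  ∣⁅x⁆∪p∣ zero    (true  ∷ p) x∉p = contradiction here x∉p
  ∣⁅x⁆∪p∣ zero    (false ∷ p) x∉p = cong (suc ∘ ∣_∣) (∪-identityˡ p)
  ∣⁅x⁆∪p∣ (suc x) (true  ∷ p) x∉p = cong suc (∣⁅x⁆∪p∣ x p (x∉p ∘ there))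
  ∣⁅x⁆∪p∣ (suc x) (false ∷ p) x∉p = ∣⁅x⁆∪p∣ x p (x∉p ∘ there)

  image : ∀ {k n} → (Fin k → Fin n) → Subset n
  image {zero}  f = ⊥
  image {suc k} f = ⁅ f zero ⁆ ∪ image (f ∘ suc)

  ∈-image⁺ : ∀ {k n} (f : Fin k → Fin n) i → f i ∈ image f
  ∈-image⁺ f zero    = x∈p∪q⁺ (inj₁ (x∈⁅x⁆ (f zero)))
  ∈-image⁺ f (suc i) = x∈p∪q⁺ (inj₂ (∈-image⁺ (f ∘ suc) i))

  ∈-image⁻ : ∀ {k n} (f : Fin k → Fin n) {x} → x ∈ image f → ∃[ i ] f i ≡ x
  ∈-image⁻ {zero}  f x∈ = contradiction x∈ ∉⊥
  ∈-image⁻ {suc k} f x∈ with x∈p∪q⁻ ⁅ f zero ⁆ (image (f ∘ suc)) x∈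
  ... | inj₁ x∈⁅⁆ = zero , sym (x∈⁅y⁆⇒x≡y (f zero) x∈⁅⁆)
  ... | inj₂ x∈im with i , eq ← ∈-image⁻ (f ∘ suc) x∈im = suc i , eq

  ∣image∣ : ∀ {k n} (f : Fin k → Fin n) → (∀ i j → f i ≡ f j → i ≡ j) → ∣ image f ∣ ≡ k
  ∣image∣ {zero}  {n} f inj = ∣⊥∣≡0 n
  ∣image∣ {suc k} f inj = trans (∣⁅x⁆∪p∣ (f zero) (image (f ∘ suc)) fresh)
    (cong suc (∣image∣ (f ∘ suc) (λ i j eq → suc-injective (inj _ _ eq))))
    where
    fresh : f zero ∉ image (f ∘ suc)
    fresh ∈im with i , eq ← ∈-image⁻ (f ∘ suc) ∈im with () ← inj (suc i) zero eq

  module _ {q : ℕ} (L : Fin (suc q) → Fin (suc (suc q ℕ.* q)))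
    (sidon : ∀ i l k j → L i ⊕ L l ≡ L k ⊕ L j → i ≡ k ⊎ i ≡ j) where

    private
      n₁ = suc q ℕ.* q
      open Modulo n₁

    -- For the doubled sums L i + L i = L j + L j both alternatives of the Sidon property say i = j.
    sidon-injective : ∀ i j → L i ≡ L j → i ≡ j
    sidon-injective i j eq with sidon i i j j (cong₂ _⊕_ eq eq)
    ... | inj₁ i≡j = i≡j
    ... | inj₂ i≡j = i≡j

    -- Rewritten as L i + L l = L k + L j, the equation leaves only i = k, since i = j is excluded;
    -- cancellation then gives j = l.
    differences-injective : ∀ {i j k l} → i ≢ j → L i ⊖ L j ≡ L k ⊖ L l → i ≡ k × j ≡ l
    differences-injective {i} {j} {k} {l} i≢j eq = conclude (sidon i l k j (⊖-≡⇒⊕-≡ (L i) (L j) (L k) (L l) eq))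
      where
      conclude : i ≡ k ⊎ i ≡ j → i ≡ k × j ≡ l
      conclude (inj₂ i≡j)  = contradiction i≡j i≢j
      conclude (inj₁ refl) = refl , sidon-injective j l (⊕-cancelˡ (L i ⊖ L j) (L j) (L l)
        (trans (⊖-⊕ (L i) (L j)) (sym (trans (cong (_⊕ L l) eq) (⊖-⊕ (L i) (L l))))))

    private
      -- The second index skips the first by `punchIn`, so this numbers the (q + 1) q ordered pairs
      -- of distinct indices, as many as there are nonzero residues.
      indices : Fin n₁ → Fin (suc q) × Fin (suc q)
      indices x with remQuot q x
      ... | i , b = i , punchIn i b

      indices-injective : ∀ x y → indices x ≡ indices y → x ≡ y
      indices-injective x y eq = begin
        x                                                        ≡⟨ combine-remQuot q x ⟨
        combine (proj₁ (remQuot {suc q} q x)) (proj₂ (remQuot {suc q} q x))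
          ≡⟨ pairs (remQuot q x) (remQuot q y) (cong proj₁ eq) (cong proj₂ eq) ⟩
        combine (proj₁ (remQuot {suc q} q y)) (proj₂ (remQuot {suc q} q y))
                                                                 ≡⟨ combine-remQuot q y ⟩
        y                                                        ∎
        where
        open ≡-Reasoning
        pairs : ∀ (u v : Fin (suc q) × Fin q) → proj₁ u ≡ proj₁ v →
          punchIn (proj₁ u) (proj₂ u) ≡ punchIn (proj₁ v) (proj₂ v) →
          combine (proj₁ u) (proj₂ u) ≡ combine (proj₁ v) (proj₂ v)
        pairs (i , b) (.i , b′) refl eq = cong (combine i) (punchIn-injective i b b′ eq)

      indices-≢ : ∀ x → proj₁ (indices x) ≢ proj₂ (indices x)
      indices-≢ x eq = punchInᵢ≢i (proj₁ (remQuot {suc q} q x)) (proj₂ (remQuot {suc q} q x)) (sym eq)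

      difference : Fin n₁ → Fin (suc n₁)
      difference x = L (proj₁ (indices x)) ⊖ L (proj₂ (indices x))

      difference≢0 : ∀ x → difference x ≢ zero
      difference≢0 x eq = indices-≢ x (sidon-injective _ _ (trans (sym (⊖-⊕ (L (proj₁ (indices x))) (L (proj₂ (indices x)))))
        (trans (cong (_⊕ L (proj₂ (indices x))) eq) (⊕-identityˡ (L (proj₂ (indices x)))))))

      difference-injective : ∀ x y → difference x ≡ difference y → x ≡ y
      difference-injective x y eq = indices-injective x y (cong₂ _,_ (proj₁ same) (proj₂ same))
        where same = differences-injective (indices-≢ x) eq

      -- There are n₁ differences and n₁ nonzero residues, so a missed residue contradicts the
      -- pigeonhole principle.
      difference-surjective : ∀ d → toℕ d ≢ 0 → ∃[ x ] difference x ≡ d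
      difference-surjective d d≢0 with any? (λ x → difference x ≟ d)
      ... | yes found = found
      ... | no  missed = contradiction (λ {x} {y} → f-injective x y) (<⇒notInjective {f = f} (ℕ.n<1+n _))
        where
        f : Fin (suc (suc n₁)) → Fin (suc n₁)
        f zero          = zero
        f (suc zero)    = d
        f (suc (suc x)) = difference x
        f-injective : ∀ x y → f x ≡ f y → x ≡ y
        f-injective zero          zero          eq = refl
        f-injective zero          (suc zero)    eq = contradiction (cong toℕ (sym eq)) d≢0
        f-injective zero          (suc (suc y)) eq = contradiction (sym eq) (difference≢0 y)
        f-injective (suc zero)    zero          eq = contradiction (cong toℕ eq) d≢0
        f-injective (suc zero)    (suc zero)    eq = refl
        f-injective (suc zero)    (suc (suc y)) eq = contradiction (y , sym eq) missed
        f-injective (suc (suc x)) zero          eq = contradiction eq (difference≢0 x)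
        f-injective (suc (suc x)) (suc zero)    eq = contradiction (x , eq) missed
        f-injective (suc (suc x)) (suc (suc y)) eq = cong (λ z → Fin.suc (suc z)) (difference-injective x y eq)

    perfect : IsPerfectDifferenceSet (image L)
    perfect d d≢0 with x , eq ← difference-surjective d d≢0 =
      (L i , L j) , (∈-image⁺ L i , ∈-image⁺ L j , eq) , unique
      where
      i = proj₁ (indices x)
      j = proj₂ (indices x)
      unique : ∀ {y} → proj₁ y ∈ image L × proj₂ y ∈ image L × proj₁ y ⊖ proj₂ y ≡ d → (L i , L j) ≡ y
      unique {t , t′} (t∈ , t′∈ , eq′) with ∈-image⁻ L t∈ | ∈-image⁻ L t′∈
      ... | k , refl | l , refl = cong₂ (λ a b → L a , L b) (proj₁ same) (proj₂ same)
        where same = differences-injective (indices-≢ x) (trans eq (sym eq′))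

-- Order, degrees and diameter of the graph

module IncidenceGraph where
  open import Defs
  open Residues
  open DifferenceSets
  open import Data.Bool.Base using (Bool; true; false)
  open import Data.Fin.Base using (Fin; zero; suc; toℕ; remQuot; combine)
  open import Data.Fin.Properties using (_≟_; any?; suc-injective; toℕ-injective; remQuot-combine; combine-remQuot; <⇒notInjective)
  open import Data.Fin.Subset using (_∈_)
  open import Data.List.Base using (tabulate)
  open import Data.List.Properties using (length-tabulate)
  open import Data.List.Membership.Propositional.Properties using (∈-tabulate⁺; ∈-tabulate⁻)
  open import Data.List.Relation.Unary.Unique.Propositional.Properties using (tabulate⁺)
  open import Data.Nat.Base as ℕ using (ℕ; zero; suc; _≤_; _<_; z≤n; s≤s)
  import Data.Nat.Properties as ℕ
  open import Data.Product using (∃-syntax; ∃₂; _×_; _,_; proj₁; proj₂)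
  open import Data.Unit.Base using (tt)
  open import Function.Base using (case_of_)
  open import Function.Bundles using (mk⇔)
  open import Level using (0ℓ)
  open import Relation.Binary.Construct.Closure.Symmetric using (fwd; bwd)
  open import Relation.Binary.PropositionalEquality
  open import Relation.Nullary using (¬_; yes; no; contradiction; Dec)
  open import Relation.Nullary.Decidable using (¬?; decidable-stable)
  open import Relation.Unary using (Pred)

  module _ {A : Set} {P : Pred A 0ℓ} where

    cardinality : ∀ {k} (f : Fin k → A) → (∀ i j → f i ≡ f j → i ≡ j) →
      (∀ i → P (f i)) → (∀ x → P x → ∃[ i ] f i ≡ x) → HasCardinality P k
    cardinality f inj sound complete =
      tabulate f , tabulate⁺ (inj _ _) ,
      (λ x → mk⇔ (λ x∈ → case ∈-tabulate⁻ x∈ of λ { (i , refl) → sound i })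
                 (λ px → case complete x px of λ { (i , refl) → ∈-tabulate⁺ i })) ,
      length-tabulate f

    cardinality₂ : ∀ {k l} (f : Fin k × Fin l → A) → (∀ i j → f i ≡ f j → i ≡ j) →
      (∀ i → P (f i)) → (∀ x → P x → ∃[ i ] f i ≡ x) → HasCardinality P (k ℕ.* l)
    cardinality₂ {k} {l} f inj sound complete = cardinality (λ x → f (remQuot l x))
      (λ x y eq → trans (sym (combine-remQuot {k} l x))
        (trans (cong (λ (i , j) → combine i j) (inj (remQuot l x) (remQuot l y) eq)) (combine-remQuot {k} l y)))
      (λ x → sound (remQuot l x))
      (λ x px → case complete x px of λ { ((i , j) , eq) → combine i j , trans (cong f (remQuot-combine i j)) eq })

  module _ (G : BipartiteGraph) where
    open BipartiteGraph G

    walk₀ : ∀ {x y} → Walk G 0 x y → x ≡ y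
    walk₀ [] = refl

    walk₁ : ∀ {x y} → Walk G 1 x y → x ~ y
    walk₁ (e ∷ []) = e

    -- There are only two sides, so changing side twice leads back.
    walk₂ : ∀ {x y} → Walk G 2 x y → side x ≡ side y
    walk₂ (e ∷ (e′ ∷ [])) = bool (stable e) (stable e′)
      where
      bool : ∀ {a b c : Bool} → a ≢ b → b ≢ c → a ≡ c
      bool {false} {b}     {false} _ _ = refl
      bool {true}  {b}     {true}  _ _ = refl
      bool {false} {false} {true}  p _ = contradiction refl p
      bool {false} {true}  {true}  _ q = contradiction refl q
      bool {true}  {false} {false} _ q = contradiction refl q
      bool {true}  {true}  {false} p _ = contradiction refl p

    distance₁ : ∀ {x y} → x ~ y → HasDistance G x y 1
    distance₁ e = e ∷ [] , λ { zero w → contradiction (cong side (walk₀ w)) (stable e)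
                             ; (suc j) w → s≤s z≤n }

    distance₂ : ∀ {x y z} → x ~ y → y ~ z → x ≢ z → HasDistance G x z 2
    distance₂ e e′ x≢z = e ∷ (e′ ∷ []) ,
      λ { zero w → contradiction (walk₀ w) x≢z
        ; (suc zero) w → contradiction (walk₂ (e ∷ (e′ ∷ []))) (stable (walk₁ w))
        ; (suc (suc j)) w → s≤s (s≤s z≤n) }

    -- Opposite sides exclude the lengths 0 and 2, and nonadjacency excludes 1.
    distance₃ : ∀ {x y} → Walk G 3 x y → side x ≢ side y → ¬ x ~ y → HasDistance G x y 3
    distance₃ p x≢y ¬x~y = p ,
      λ { zero w → contradiction (cong side (walk₀ w)) x≢y
        ; (suc zero) w → contradiction (walk₁ w) ¬x~y
        ; (suc (suc zero)) w → contradiction (walk₂ w) x≢y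
        ; (suc (suc (suc j))) w → s≤s (s≤s (s≤s z≤n)) }

    reverse₃ : ∀ {x y} → Walk G 3 x y → Walk G 3 y x
    reverse₃ (e ∷ (e′ ∷ (e″ ∷ []))) = ~-sym e″ ∷ (~-sym e′ ∷ (~-sym e ∷ []))

  module _ {k n₁ : ℕ} (L : Fin (suc k) → Fin (suc n₁)) (L-injective : ∀ i j → L i ≡ L j → i ≡ j)
    (S-perfect : IsPerfectDifferenceSet (image L)) (k<n₁ : k < n₁) where

    private
      s = suc k
      n = suc n₁
      S = image L
      open Modulo n₁

    -- If every residue were hit, choosing an index for each would inject `Fin n` into `Fin s`,
    -- although s < n.
    missed : ∃[ u ] ∀ i → L i ≢ u
    missed with any? (λ u → ¬? (any? (λ i → L i ≟ u)))
    ... | yes (u , ¬hit) = u , λ i eq → ¬hit (i , eq)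
    ... | no  all-hit    = contradiction (λ {x} {y} → index-injective x y) (<⇒notInjective {f = index} (s≤s k<n₁))
      where
      hit : ∀ u → ∃[ i ] L i ≡ u
      hit u = decidable-stable (any? (λ i → L i ≟ u)) (λ ¬hit → all-hit (u , ¬hit))
      index : Fin n → Fin s
      index u = proj₁ (hit u)
      index-injective : ∀ x y → index x ≡ index y → x ≡ y
      index-injective x y eq = trans (sym (proj₂ (hit x))) (trans (cong L eq) (proj₂ (hit y)))

    -- The difference set writes u - u′ as t - t′. The rearranged form without subtraction serves
    -- common neighbours on either side.
    separated : ∀ (u u′ : Fin n) → u ≢ u′ → ∃₂ λ t t′ → t ∈ S × t′ ∈ S × u ⊕ t′ ≡ u′ ⊕ t
    separated u u′ u≢u′ = from (S-perfect (u ⊖ u′) nonzero)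
      where
      nonzero : toℕ (u ⊖ u′) ≢ 0
      nonzero eq = u≢u′ (trans (sym (⊖-⊕ u u′)) (trans (cong (_⊕ u′) (toℕ-injective {j = zero} eq)) (⊕-identityˡ u′)))
      from : (∃[ p ] (proj₁ p ∈ S × proj₂ p ∈ S × proj₁ p ⊖ proj₂ p ≡ u ⊖ u′) × _) → _
      from ((t , t′) , (t∈ , t′∈ , eq) , _) = t , t′ , t∈ , t′∈ ,
        trans (⊖-≡⇒⊕-≡ u u′ t t′ (sym eq)) (⊕-comm t u′)

    module _ (m : ℕ) where

      private
        G = G[ m , S ]
      open BipartiteGraph G

      order : HasOrder G ((m ℕ.+ 1) ℕ.* n)
      order = subst (HasOrder G) (cong (ℕ._* n) (ℕ.+-comm 1 m))
        (cardinality₂ (λ x → x) (λ _ _ eq → eq) (λ _ → tt) (λ x _ → x , refl))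

      -- The neighbours of (0, u) are the (l, u - σ), one for each of the m layers and each σ in S.
      degree₀ : ∀ u → HasDegree G (zero , u) (m ℕ.* s)
      degree₀ u = cardinality₂ f f-injective
        (λ (l , i) → bwd (edge l (∈-image⁺ L i) (sym (⊖-⊕ u (L i)))))
        (λ { x (bwd (edge l σ∈ refl)) → case ∈-image⁻ L σ∈ of λ
             { (i , refl) → (l , i) , cong (suc l ,_) (⊕-⊖ (proj₂ x) (L i)) } })
        where
        f : Fin m × Fin s → Vertex
        f (l , i) = suc l , u ⊖ L i
        f-injective : ∀ x y → f x ≡ f y → x ≡ y
        f-injective (l , i) (l′ , j) eq = cong₂ _,_ (suc-injective (cong proj₁ eq)) (L-injective i j
          (⊕-cancelˡ (u ⊖ L i) (L i) (L j) (trans (⊖-⊕ u (L i)) (sym (trans (cong (_⊕ L j) (cong proj₂ eq)) (⊖-⊕ u (L j)))))))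

      degree₁ : ∀ l v → HasDegree G (suc l , v) s
      degree₁ l v = cardinality (λ i → zero , v ⊕ L i)
        (λ i j eq → L-injective i j (⊕-cancelˡ v (L i) (L j) (cong proj₂ eq)))
        (λ i → fwd (edge l (∈-image⁺ L i) refl))
        (λ { x (fwd (edge l σ∈ refl)) → case ∈-image⁻ L σ∈ of λ { (i , refl) → i , refl } })

      biregular : IsBiregular G (m ℕ.* s) s
      biregular = false ,
        (λ { (zero , u) _ → degree₀ u ; (suc l , v) () }) ,
        (λ { (zero , u) () ; (suc l , v) _ → degree₁ l v })

      adjacent? : ∀ u l v → Dec ((zero , u) ~ (suc l , v))
      adjacent? u l v with any? (λ i → u ≟ v ⊕ L i)
      ... | yes (i , eq) = yes (bwd (edge l (∈-image⁺ L i) eq))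
      ... | no  ¬∃i      = no λ { (bwd (edge l σ∈ eq)) → case ∈-image⁻ L σ∈ of λ { (i , refl) → ¬∃i (i , eq) } }

      -- For v = v′ any element of S gives a common neighbour; otherwise v + t′ = v′ + t does.
      common₁ : ∀ l l′ (v v′ : Fin n) → ∃[ y ] (suc l , v) ~ y × y ~ (suc l′ , v′)
      common₁ l l′ v v′ with v ≟ v′
      ... | yes refl = (zero , v ⊕ L zero) , fwd (edge l (∈-image⁺ L zero) refl) , bwd (edge l′ (∈-image⁺ L zero) refl)
      ... | no  v≢v′ =
        let t , t′ , t∈ , t′∈ , eq = separated v v′ v≢v′ in
        (zero , v ⊕ t′) , fwd (edge l t′∈ refl) , bwd (edge l′ t∈ eq)

      -- From the residue u - t, adding t leads to u and adding t′ leads to u′. The argument in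
      -- `Fin m` supplies a layer for this vertex.
      common₀ : Fin m → ∀ (u u′ : Fin n) → u ≢ u′ → ∃[ y ] (zero , u) ~ y × y ~ (zero , u′)
      common₀ l u u′ u≢u′ =
        let t , t′ , t∈ , t′∈ , eq = separated u u′ u≢u′ in
        (suc l , u ⊖ t) , bwd (edge l t∈ (sym (⊖-⊕ u t))) , fwd (edge l t′∈ (meet t t′ eq))
        where
        open ≡-Reasoning
        meet : ∀ t t′ → u ⊕ t′ ≡ u′ ⊕ t → u′ ≡ (u ⊖ t) ⊕ t′
        meet t t′ eq = ⊕-cancelʳ t u′ ((u ⊖ t) ⊕ t′) (begin
          u′ ⊕ t                ≡⟨ eq ⟨
          u ⊕ t′                ≡⟨ cong (_⊕ t′) (⊖-⊕ u t) ⟨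
          ((u ⊖ t) ⊕ t) ⊕ t′    ≡⟨ ⊕-assoc (u ⊖ t) t t′ ⟩
          (u ⊖ t) ⊕ (t ⊕ t′)    ≡⟨ cong ((u ⊖ t) ⊕_) (⊕-comm t t′) ⟩
          (u ⊖ t) ⊕ (t′ ⊕ t)    ≡⟨ ⊕-assoc (u ⊖ t) t′ t ⟨
          ((u ⊖ t) ⊕ t′) ⊕ t    ∎)

      -- Two steps lead from (0, u) to the neighbour (0, v + σ) of the target, where σ is `L zero`.
      -- Nonadjacency makes u different from v + σ, as `common₀` requires.
      walk₃ : ∀ u l v → ¬ (zero , u) ~ (suc l , v) → Walk G 3 (zero , u) (suc l , v)
      walk₃ u l v ¬adj =
        let σ∈ = ∈-image⁺ L zero
            _ , e , e′ = common₀ l u (v ⊕ L zero) (λ eq → ¬adj (bwd (edge l σ∈ eq)))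
        in e ∷ (e′ ∷ (bwd (edge l σ∈ refl) ∷ []))

      distance : Fin m → ∀ x y → ∃[ d ] HasDistance G x y d × d ≤ 3
      distance l₀ (zero , u) (zero , u′) with u ≟ u′
      ... | yes refl = 0 , ([] , λ _ _ → z≤n) , z≤n
      ... | no  u≢u′ = let _ , e , e′ = common₀ l₀ u u′ u≢u′ in
        2 , distance₂ G e e′ (λ eq → u≢u′ (cong proj₂ eq)) , s≤s (s≤s z≤n)
      distance _ (zero , u) (suc l , v) with adjacent? u l v
      ... | yes adj = 1 , distance₁ G adj , s≤s z≤n
      ... | no ¬adj = 3 , distance₃ G (walk₃ u l v ¬adj) (λ ()) ¬adj , ℕ.≤-refl
      distance _ (suc l , v) (zero , u) with adjacent? u l v
      ... | yes adj = 1 , distance₁ G (~-sym adj) , s≤s z≤n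
      ... | no ¬adj = 3 , distance₃ G (reverse₃ G (walk₃ u l v ¬adj)) (λ ()) (λ adj → ¬adj (~-sym adj)) , ℕ.≤-refl
      distance _ (suc l , v) (suc l′ , v′) with l ≟ l′ | v ≟ v′
      ... | yes refl | yes refl = 0 , ([] , λ _ _ → z≤n) , z≤n
      ... | no l≢l′  | _ = let _ , e , e′ = common₁ l l′ v v′ in
        2 , distance₂ G e e′ (λ { refl → l≢l′ refl }) , s≤s (s≤s z≤n)
      distance _ (suc l , v) (suc l′ , v′) | _ | no v≢v′ = let _ , e , e′ = common₁ l l′ v v′ in
        2 , distance₂ G e e′ (λ { refl → v≢v′ refl }) , s≤s (s≤s z≤n)

      -- The neighbours of (l, 0) are the (0, σ) with σ in S, so a residue outside S gives a
      -- nonadjacent vertex on the opposite side, at distance 3.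
      diameter : Fin m → HasDiameter G 3
      diameter l₀ = distance l₀ , (zero , proj₁ missed) , (suc l₀ , zero) ,
        distance₃ G (walk₃ _ l₀ zero ¬adj) (λ ()) ¬adj
        where
        ¬adj : ¬ (zero , proj₁ missed) ~ (suc l₀ , zero)
        ¬adj (bwd (edge _ σ∈ eq)) = case ∈-image⁻ L σ∈ of λ
          { (i , Li≡σ) → proj₂ missed i (trans Li≡σ (sym (trans eq (⊕-identityˡ _)))) }

-- Assembly for a prime power q

open import Defs
open import Data.Fin.Subset using (Subset; ∣_∣)
open import Data.Nat.Base using (ℕ; _+_; _*_; _∸_; _^_; _≥_)
open import Data.Product using (_×_; Σ-syntax)
open import Relation.Binary.PropositionalEquality using (_≡_)

open Frobenius using (frobenius^-+)
open Semisimple using (IsSplittingDomain; splittingDomain)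
open Singer using (L; sidon)
open DifferenceSets using (image; perfect; ∣image∣; sidon-injective)
open IncidenceGraph using (order; biregular; diameter)
open import Algebra.Bundles using (CommutativeRing)
open import Data.Fin.Base using (Fin; zero)
open import Data.Nat.Base using (zero; suc; _≤_; _<_; s≤s; z≤n; nonTrivial⇒n>1)
import Data.Nat.Properties as ℕ
open import Data.Nat.Primality using (¬prime[0]; prime⇒nonTrivial; prime⇒nonZero)
open import Data.Product using (_,_; ∃-syntax)
open import Data.Sum.Base using (_⊎_)
open import Level using (0ℓ)
open import Relation.Binary.PropositionalEquality using (refl; sym; cong; subst; module ≡-Reasoning)
open import Relation.Nullary using (contradiction)

IsSidon : ∀ {k n} → (Fin k → Fin n) → Set
IsSidon f = ∀ i l k j → f i ⊕ f l ≡ f k ⊕ f j → i ≡ k ⊎ i ≡ j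

-- q³ - 1 = (q - 1)(q² + q + 1)
cubic : ∀ q₁ → suc (q₁ * suc (suc (suc q₁) * suc q₁)) ≡ suc q₁ * (suc q₁ * suc q₁)
cubic = solve 1 (λ x → let q = con 1 :+ x in
  con 1 :+ x :* (con 1 :+ (con 1 :+ q) :* q) := q :* (q :* q)) refl
  where
  open import Data.Nat.Solver
  open +-*-Solver

1<primePower : ∀ {q} → IsPrimePower q → 1 < q
1<primePower (p , k@(suc k′) , pr , _ , refl) = ℕ.<-≤-trans (nonTrivial⇒n>1 p {{prime⇒nonTrivial pr}})
  (subst (_≤ p ^ k) (ℕ.*-identityʳ p) (ℕ.*-monoʳ-≤ p (ℕ.m^n>0 p {{prime⇒nonZero pr}} k′)))

singer : ∀ q → IsPrimePower q → ∃[ f ] IsSidon {suc q} {suc (suc q * q)} f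
singer zero             pp = contradiction (1<primePower pp) λ ()
singer (suc zero)       pp = contradiction (1<primePower pp) λ { (s≤s ()) }
singer (suc (suc _))    (zero , _ , pr , _) = contradiction pr ¬prime[0]
singer q@(suc q₁@(suc q₂)) (p@(suc p′) , k , pr , _ , q≡) = fromField (splittingDomain p′ m (k * 3) pr p³ᵏ≡)
  where
  -- This form makes `suc m` compute to `q₁ * suc (suc q * q)`, so that the factorisation of N holds
  -- by `refl`.
  m = suc q * q + q₂ * suc (suc q * q)

  p³ᵏ≡ : p ^ (k * 3) ≡ suc (suc m)
  p³ᵏ≡ = begin
    p ^ (k * 3)        ≡⟨ ℕ.^-*-assoc p k 3 ⟨
    (p ^ k) ^ 3        ≡⟨ cong (_^ 3) q≡ ⟨
    q * (q * (q * 1))  ≡⟨ cong (λ x → q * (q * x)) (ℕ.*-identityʳ q) ⟩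
    q * (q * q)        ≡⟨ cubic q₁ ⟨
    suc (suc m)        ∎
    where open ≡-Reasoning

  fromField : Σ[ K ∈ CommutativeRing 0ℓ 0ℓ ] IsSplittingDomain K p (suc m) (suc (suc m)) → ∃[ f ] IsSidon f
  fromField (K , D) = L K q₁ n₁ m D frobenius 1<q refl (cubic q₁) , sidon K q₁ n₁ m D frobenius 1<q refl (cubic q₁)
    where
    n₁ = suc q * q
    1<q = s≤s (s≤s z≤n)
    open CommutativeRing K using (semiring; _≈_) renaming (_+_ to _⊞_)
    open import Algebra.Properties.Semiring.Exp semiring using () renaming (_^_ to _↑_)
    frobenius : ∀ x y → (x ⊞ y) ↑ q ≈ (x ↑ q) ⊞ (y ↑ q)
    frobenius = subst (λ e → ∀ x y → (x ⊞ y) ↑ e ≈ (x ↑ e) ⊞ (y ↑ e)) (sym q≡)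
      (frobenius^-+ K pr (IsSplittingDomain.char D) k)

-- With s = q + 1 the difference s² - s is s q; the right side exhibits the modulus as a successor,
-- as the residue arithmetic requires.
order≡ : ∀ q → (1 + q) ^ 2 ∸ (1 + q) + 1 ≡ suc (suc q * q)
order≡ q = begin
  s * (s * 1) ∸ s + 1   ≡⟨ ℕ.+-comm _ 1 ⟩
  suc (s * (s * 1) ∸ s) ≡⟨ cong (λ x → suc (s * x ∸ s)) (ℕ.*-identityʳ s) ⟩
  suc (s * s ∸ s)       ≡⟨ cong (λ x → suc (x ∸ s)) (ℕ.*-suc s q) ⟩
  suc (s + s * q ∸ s)   ≡⟨ cong suc (ℕ.m+n∸m≡n s (s * q)) ⟩
  suc (s * q)           ∎
  where
  open ≡-Reasoning
  s = suc q

-- The modulus is a separate argument so that the result can be transported along `order≡`.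
Conclusion : ℕ → ℕ → Set
Conclusion q n =
  Σ[ S ∈ Subset n ]
    IsPerfectDifferenceSet S ×
    ∣ S ∣ ≡ 1 + q ×
    (∀ m → m ≥ 1 → HasOrder G[ m , S ] ((m + 1) * n) × IsBiregular G[ m , S ] (m * (1 + q)) (1 + q) × HasDiameter G[ m , S ] 3)

conclusion : ∀ {q} → 1 < q → (∃[ f ] IsSidon {suc q} {suc (suc q * q)} f) → Conclusion q (suc (suc q * q))
conclusion {q} 1<q (f , f-sidon) =
  image f , S-perfect , ∣image∣ f f-injective , λ where
    (suc m) _ → order f f-injective S-perfect q<n₁ (suc m) ,
                biregular f f-injective S-perfect q<n₁ (suc m) ,
                -- As the number of layers is positive, `zero` is available as a layer of V₁.
                diameter f f-injective S-perfect q<n₁ (suc m) zero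
  where
  f-injective = sidon-injective f f-sidon
  S-perfect = perfect f f-sidon
  -- The right side is q + q² with q² positive; the inequality leaves a residue outside S.
  q<n₁ : q < suc q * q
  q<n₁ = ℕ.m<m+n q (ℕ.*-mono-< {0} {q} {0} {q} (ℕ.<-trans (s≤s z≤n) 1<q) (ℕ.<-trans (s≤s z≤n) 1<q))

corollary2p3 : ∀ (q : ℕ) → IsPrimePower q →
    let s = 1 + q
        n = s ^ 2 ∸ s + 1
    in Σ[ S ∈ Subset n ]
         IsPerfectDifferenceSet S ×
         ∣ S ∣ ≡ s ×
         (∀ (m : ℕ) → m ≥ 1 →
            HasOrder G[ m , S ] ((m + 1) * n) ×
            IsBiregular G[ m , S ] (m * s) s ×
            HasDiameter G[ m , S ] 3)
corollary2p3 q pp = subst (Conclusion q) (sym (order≡ q)) (conclusion (1<primePower pp) (singer q pp))
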